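{- Let $f,f'$ range over $\mathbb{N}^{\mathbb{N}}$ and $\vec{x}$ over $\mathbb{N}^l$. Let $P(|f|,|\vec{x}|)$ and $Q(|f|,|\vec{x}|)$ be second order polynomials and let $G(f,\vec{x})$ and $H(f,\vec{x},z,y)$ be basic feasible functionals. Suppose that the functional $F^{\ast}(f,\vec{x},y)$ satisfies, for all $f$ and $\vec{x}$: 1. $F^{\ast}(f,\vec{x},0)=G(f,\vec{x})$; 2. $F^{\ast}(f,\vec{x},y+1)=H\bigl(f,\vec{x},F^{\ast}(f,\vec{x},y),y\bigr)$ for all $y\in\mathbb{N}$; 3. $|F^{\ast}(f,\vec{x},y)|\le Q(|f|,|\vec{x}|)$ for all $y\le P(|f|,|\vec{x}|)$; 4. $F^{\ast}(f,\vec{x},y)=F^{\ast}(f,\vec{x},P(|f|,|\vec{x}|))$ for all $y\ge P(|f|,|\vec{x}|)$; 5. for every $f'\in\mathbb{N}^{\mathbb{N}}$: if $F^{\ast}(f,\vec{x},y)=F^{\ast}(f',\vec{x},y)$ for all $y\le P(|f|,|\vec{x}|)$, then $F^{\ast}(f,\vec{x},y)=F^{\ast}(f',\vec{x},y)$ for all $y\in\mathbb{N}$. Let $F$ be the functional defined by $F(f,\vec{x})=F^{\ast}(f,\vec{x},P(|f|,|\vec{x}|))$. (That is, $F$ is defined from $G$ and $H$ by polynomially bounded recursion of polynomial length with bounds $(Q,P)$.) Then $F(f,\vec{x})$ is a basic feasible functional.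
   Context: **Notation.** For $x\in\mathbb{N}$, $|x|$ is the length of the binary representation of $x$, with $|0|=0$; $x\# y=2^{|x|\cdot|y|}$. For $\vec{x}=(x_1,\dots,x_l)$, $|\vec{x}|=(|x_1|,\dots,|x_l|)$. A type 2 functional of rank $(k,l)$ is a (total) function $F:(\mathbb{N}^{\mathbb{N}})^k\times\mathbb{N}^l\to\mathbb{N}$. **Basic feasible functionals.** The class of basic feasible functionals is the least class of type 2 functionals that contains the functions $\mathbf{o}(x)=0$, $s_0(x)=2x$, $s_1(x)=2x+1$, $i^n_k(x_1,\dots,x_n)=x_k$, $x\# y$, and the application functional $Ap(f,x)=f(x)$, and is closed under: - *functional composition*: $F(\vec{f},\vec{x})=H(\vec{f},G_1(\vec{f},\vec{x}),\dots,G_m(\vec{f},\vec{x}),\vec{x})$; - *expansion*: $F(\vec{f},\vec{g},\vec{x},\vec{y})=G(\vec{f},\vec{x})$ (lists of arguments being understood up to order); - *limited recursion on notation* from $G,H_1,H_2,K$: $F(\vec{f},\vec{x},0)=G(\vec{f},\vec{x})$; $F(\vec{f},\vec{x},2y)=H_1(\vec{f},\vec{x},y,F(\vec{f},\vec{x},y))$ for $y>0$; $F(\vec{f},\vec{x},2y+1)=H_2(\vec{f},\vec{x},y,F(\vec{f},\vec{x},y))$; provided $|F(\vec{f},\vec{x},y)|\le|K(\vec{f},\vec{x},y)|$ for all $\vec{f},\vec{x},y$. **Second order polynomials.** For $f:\mathbb{N}\to\mathbb{N}$, the norm $|f|:\mathbb{N}\to\mathbb{N}$ is $|f|(n)=\max_{|y|\le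 n}|f(y)|$. Second order polynomials in $|f_0|,|f_1|,\dots$ and $|x_0|,|x_1|,\dots$ form the least set of terms containing the constants $n\in\mathbb{N}$ and all $|x_i|$, and such that if $P,Q$ are in the set then so are $P+Q$, $P\cdot Q$ and $|f_i|(P)$. They are evaluated with $|f_i|$ interpreted as the norm of $f_i$ and $|x_i|$ as the length of $x_i$. -}

module Defs where

open import Data.Digit using (Expansion; 0b; 1b; fromDigits)
open import Data.Fin.Base using (Fin; zero; suc; toℕ)
open import Data.Fin.Permutation using (Permutation′; _⟨$⟩ʳ_)
open import Data.Fin.Properties using (toℕ<n)
open import Data.List.Base as List using (List; []; _∷_; length; filter; upTo)
open import Data.List.Extrema.Nat using (max)
open import Data.Nat.Base
open import Data.Nat.Properties
open import Data.Vec.Base using (Vec; []; _∷_; [_]; _++_; _∷ʳ_; lookup; tabulate)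
open import Relation.Binary.PropositionalEquality
  using (_≡_; refl; sym; cong; subst)

------------------------------------------------------------------------
-- Binary length

increment : Expansion 2 → Expansion 2
increment []               = 1b ∷ []
increment (zero     ∷ ds)  = 1b ∷ ds
increment (suc zero ∷ ds)  = 0b ∷ increment ds

-- Least significant digit first, without superfluous zeros; in
-- particular 0 is represented by the empty expansion.
binary : ℕ → Expansion 2
binary zero    = []
binary (suc n) = increment (binary n)

∣_∣ : ℕ → ℕ
∣ x ∣ = length (binary x)

infix 7 _#_

_#_ : ℕ → ℕ → ℕ
x # y = 2 ^ (∣ x ∣ * ∣ y ∣)

fromDigits-increment : ∀ ds → fromDigits (increment ds) ≡ suc (fromDigits ds)
fromDigits-increment []              = refl
fromDigits-increment (zero     ∷ ds) = refl
fromDigits-increment (suc zero ∷ ds) =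
  cong (_* 2) (fromDigits-increment ds)

fromDigits-binary : ∀ n → fromDigits (binary n) ≡ n
fromDigits-binary zero    = refl
fromDigits-binary (suc n)
  rewrite fromDigits-increment (binary n) = cong suc (fromDigits-binary n)

fromDigits<2^length : (ds : Expansion 2) → fromDigits ds < 2 ^ length ds
fromDigits<2^length []       = s≤s z≤n
fromDigits<2^length (d ∷ ds) = begin-strict
  toℕ d + fromDigits ds * 2  <⟨ +-monoˡ-< (fromDigits ds * 2) (toℕ<n d) ⟩
  suc (fromDigits ds) * 2    ≤⟨ *-monoˡ-≤ 2 (fromDigits<2^length ds) ⟩
  2 ^ length ds * 2          ≡⟨ *-comm (2 ^ length ds) 2 ⟩
  2 * 2 ^ length ds          ∎
  where open ≤-Reasoning

n<2^∣n∣ : ∀ n → n < 2 ^ ∣ n ∣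
n<2^∣n∣ n =
  subst (_< 2 ^ ∣ n ∣) (fromDigits-binary n) (fromDigits<2^length (binary n))

-- The maximum of ∣ f y ∣ over all y with ∣ y ∣ ≤ n: by n<2^∣n∣ every
-- such y occurs in upTo (2 ^ n).
norm : (ℕ → ℕ) → ℕ → ℕ
norm f n =
  max 0 (List.map (λ y → ∣ f y ∣) (filter (λ y → ∣ y ∣ ≤? n) (upTo (2 ^ n))))

------------------------------------------------------------------------
-- Basic feasible functionals

-- Type 2 functionals of rank (k , l)
Functional : ℕ → ℕ → Set
Functional k l = Vec (ℕ → ℕ) k → Vec ℕ l → ℕ

permute : ∀ {A : Set} {n} → Permutation′ n → Vec A n → Vec A n
permute π xs = tabulate (λ i → lookup xs (π ⟨$⟩ʳ i))

𝐨 s₀ s₁ : Functional 0 1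
𝐨  [] (x ∷ []) = 0
s₀ [] (x ∷ []) = 2 * x
s₁ [] (x ∷ []) = 2 * x + 1

𝐢 : ∀ {n} → Fin n → Functional 0 n
𝐢 k [] xs = lookup xs k

smash : Functional 0 2
smash [] (x ∷ y ∷ []) = x # y

Ap : Functional 1 1
Ap (f ∷ []) (x ∷ []) = f x

-- In each closure clause the new functional F is given by its defining
-- equations, so the class is closed under pointwise equality (take
-- m = 0 in composition). Being able to list the arguments of an
-- expansion in any order is the separate clause reordering.
data BFF : ∀ {k l} → Functional k l → Set where
  zeroᶠ      : BFF 𝐨
  double     : BFF s₀
  double+1   : BFF s₁
  projection : ∀ {n} (k : Fin n) → BFF (𝐢 k)
  smashᶠ     : BFF smash
  apply      : BFF Ap

  composition :
    ∀ {k l m} {F : Functional k l}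
      {H : Functional k (m + l)} {G : Fin m → Functional k l} →
    BFF H → (∀ i → BFF (G i)) →
    (∀ fs xs → F fs xs ≡ H fs (tabulate (λ i → G i fs xs) ++ xs)) →
    BFF F

  expansion :
    ∀ {k k′ l l′} {F : Functional (k + k′) (l + l′)} {G : Functional k l} →
    BFF G →
    (∀ fs gs xs ys → F (fs ++ gs) (xs ++ ys) ≡ G fs xs) →
    BFF F

  reordering :
    ∀ {k l} {F G : Functional k l} (π : Permutation′ k) (ρ : Permutation′ l) →
    BFF G →
    (∀ fs xs → F fs xs ≡ G (permute π fs) (permute ρ xs)) →
    BFF F

  limitedRecursion :
    ∀ {k l} {F K : Functional k (suc l)}
      {G : Functional k l} {H₁ H₂ : Functional k (suc (suc l))} →
    BFF G → BFF H₁ → BFF H₂ → BFF K →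
    (∀ fs xs → F fs (xs ∷ʳ 0) ≡ G fs xs) →
    (∀ fs xs y → y > 0 →
      F fs (xs ∷ʳ 2 * y) ≡ H₁ fs (xs ∷ʳ y ∷ʳ F fs (xs ∷ʳ y))) →
    (∀ fs xs y →
      F fs (xs ∷ʳ 2 * y + 1) ≡ H₂ fs (xs ∷ʳ y ∷ʳ F fs (xs ∷ʳ y))) →
    (∀ fs xs y → ∣ F fs (xs ∷ʳ y) ∣ ≤ ∣ K fs (xs ∷ʳ y) ∣) →
    BFF F

------------------------------------------------------------------------
-- Second order polynomials in ∣f₀∣, …, ∣fₖ₋₁∣ and ∣x₀∣, …, ∣xₗ₋₁∣

infixl 6 _⊕_
infixl 7 _⊗_

data SOPoly (k l : ℕ) : Set where
  const   : ℕ → SOPoly k l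
  len     : Fin l → SOPoly k l
  _⊕_ _⊗_ : SOPoly k l → SOPoly k l → SOPoly k l
  app     : Fin k → SOPoly k l → SOPoly k l

⟦_⟧ : ∀ {k l} → SOPoly k l → Functional k l
⟦ const n ⟧ fs xs = n
⟦ len i   ⟧ fs xs = ∣ lookup xs i ∣
⟦ P ⊕ Q   ⟧ fs xs = ⟦ P ⟧ fs xs + ⟦ Q ⟧ fs xs
⟦ P ⊗ Q   ⟧ fs xs = ⟦ P ⟧ fs xs * ⟦ Q ⟧ fs xs
⟦ app i P ⟧ fs xs = norm (lookup fs i) (⟦ P ⟧ fs xs)

{-# OPTIONS --safe #-}

-- Let P and Q have nesting depth d. Guesses z₁, …, z_d for the lengths of
-- the norm values occurring in P and Q yield a first order length bound
-- for the recursion from f truncated according to the guesses. Running the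
-- recursion under this bound, and aborting at the first query whose answer
-- refutes a guess, either produces F (f , x), by condition 5 applied to the
-- truncation of f, or returns the refuting query. The guesses are found
-- from the last to the first. Each is the answer to some earlier query y of
-- known length bound b, so that it is refuted at most 2 ^ b times on its
-- level; a recursion of length b + 1 over recursions of length ∣ f y ∣ + 1 is
-- enough to exhaust these refutations.

module Submission where

open import Defs
open import Data.Digit using (Expansion; 0b; 1b; fromDigits)
open import Data.Empty using (⊥)
open import Data.Fin.Base
  using (Fin; zero; suc; toℕ; fromℕ; fromℕ<; inject₁; splitAt; _↑ˡ_; _↑ʳ_)
open import Data.Fin.Permutation as Permutation using (Permutation′; transpose; _⟨$⟩ʳ_)
import Data.Fin.Properties as Fin
open import Data.Fin.Relation.Unary.Top using (View; view; ‵fromℕ; ‵inject₁)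
open import Data.List.Base using ([]; _∷_; length; upTo)
open import Data.List.Extrema.Nat using (max≤v⁺; v≤max⁺)
open import Data.List.Membership.Propositional using (lose)
open import Data.List.Membership.Propositional.Properties using (∈-filter⁺; ∈-upTo⁺; ∈-map⁺)
import Data.List.Relation.Unary.All.Properties as All
open import Data.Nat.Base
open import Data.Nat.Induction using (<-rec)
open import Data.Nat.Properties
open import Data.Product.Base using (_×_; _,_; proj₁; proj₂; ∃)
open import Data.Sum.Base using (_⊎_; inj₁; inj₂)
open import Data.Unit.Base using (⊤; tt)
open import Data.Vec.Base
  using (Vec; []; _∷_; [_]; _++_; _∷ʳ_; lookup; tabulate; replicate; take; drop; head; tail)
open import Data.Vec.Properties
  using (tabulate∘lookup; lookup∘tabulate; tabulate-cong; lookup-replicate;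
         lookup-++ˡ; lookup-++ʳ; take++drop≡id)
open import Function.Base using (_∘_)
open import Relation.Binary.PropositionalEquality
  using (_≡_; refl; sym; trans; cong; cong₂; subst; subst₂; module ≡-Reasoning)
open import Relation.Nullary
  using (Dec; yes; no; ¬_; contradiction; _×-dec_; _⊎-dec_)

-- The norm is a maximum over exponentially many values, so `P` and `Q` cannot in general be
-- evaluated feasibly; yet limited recursion demands a bound that holds for all arguments, wrong
-- guesses included. The truncation resolves this: it obeys any guesses whatever, so its own
-- recursion always stays below a majorant computed from them, and as long as a run on `f` has not
-- aborted, it has the values of the truncation. A guess that survives need not equal the norm; it
-- has to withstand only the queries actually made. Recursion on notation makes only as many steps
-- as its argument has digits, too few to go through the possible refutations one by one. But each
-- replacement of a query `y` strictly raises `∣ f y ∣`, so after `t` replacements a loop of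
-- `∣ f y ∣ + 1` steps is longer than everything before it. The number of steps doubles with each
-- loop.

private variable
  k l m n : ℕ

-- Binary lengths, parity and halving.

-- `binary` counts by increments, so that doubling shifts the digits needs an induction; the two
-- parities feed each other, one increment at a time.
binary-double+1 : ∀ y → binary (suc (2 * y)) ≡ 1b ∷ binary y
binary-double-suc : ∀ y → binary (2 * suc y) ≡ 0b ∷ binary (suc y)

binary-double+1 zero    = refl
binary-double+1 (suc y) = cong increment (binary-double-suc y)

binary-double-suc y rewrite +-suc y (y + 0) =
  cong increment (binary-double+1 y)

∣2*n∣ : ∀ n → n > 0 → ∣ 2 * n ∣ ≡ suc ∣ n ∣
∣2*n∣ (suc n) _ = cong length (binary-double-suc n)

∣2*n+1∣ : ∀ n → ∣ 2 * n + 1 ∣ ≡ suc ∣ n ∣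
∣2*n+1∣ n rewrite +-comm (2 * n) 1 = cong length (binary-double+1 n)

length-increment : ∀ ds → length ds ≤ length (increment ds) ×
                          length (increment ds) ≤ suc (length ds)
length-increment []             = z≤n , ≤-refl
length-increment (zero ∷ ds)     = ≤-refl , n≤1+n _
length-increment (suc zero ∷ ds) with length-increment ds
... | p , q = s≤s p , s≤s q

∣∣-mono-≤ : ∀ {m n} → m ≤ n → ∣ m ∣ ≤ ∣ n ∣
∣∣-mono-≤ m≤n = go (≤⇒≤′ m≤n)
  where
  go : ∀ {m n} → m ≤′ n → ∣ m ∣ ≤ ∣ n ∣
  go ≤′-refl        = ≤-refl
  go (≤′-step {n} p) = ≤-trans (go p) (proj₁ (length-increment (binary n)))

∣n∣≤n : ∀ n → ∣ n ∣ ≤ n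
∣n∣≤n zero    = z≤n
∣n∣≤n (suc n) = ≤-trans (proj₂ (length-increment (binary n))) (s≤s (∣n∣≤n n))

∣2*n∣≤suc : ∀ n → ∣ 2 * n ∣ ≤ suc ∣ n ∣
∣2*n∣≤suc zero    = z≤n
∣2*n∣≤suc (suc n) = ≤-reflexive (∣2*n∣ (suc n) (s≤s z≤n))

∣n∣≡0⇒n≡0 : ∀ n → ∣ n ∣ ≡ 0 → n ≡ 0
∣n∣≡0⇒n≡0 n ∣n∣≡0 with n<2^∣n∣ n
... | n<2^∣n∣ rewrite ∣n∣≡0 = n<1⇒n≡0 n<2^∣n∣

∣2^n∣ : ∀ n → ∣ 2 ^ n ∣ ≡ suc n
∣2^n∣ zero    = refl
∣2^n∣ (suc n) = trans (∣2*n∣ (2 ^ n) (m^n>0 2 n)) (cong suc (∣2^n∣ n))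

∣#∣ : ∀ x y → ∣ x # y ∣ ≡ suc (∣ x ∣ * ∣ y ∣)
∣#∣ x y = ∣2^n∣ (∣ x ∣ * ∣ y ∣)

data Halving : ℕ → Set where
  even : ∀ y → Halving (2 * y)
  odd  : ∀ y → Halving (2 * y + 1)

halving : ∀ n → Halving n
halving zero = even 0
halving (suc n) with halving n
... | even y = subst Halving (+-comm (2 * y) 1) (odd y)
... | odd y  = subst Halving (trans (*-suc 2 y) (cong suc (+-comm 1 (2 * y)))) (even (suc y))

binary-induction :
  (P : ℕ → Set) → P 0 → (∀ y → y > 0 → P y → P (2 * y)) →
  (∀ y → P y → P (2 * y + 1)) → ∀ n → P n
binary-induction P base step₀ step₁ = <-rec P go
  where
  go : ∀ n → (∀ {m} → m < n → P m) → P n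
  go n rec with halving n
  ... | even zero      = base
  ... | even y@(suc _) = step₀ y (s≤s z≤n) (rec (m<n*m y 2 ≤-refl))
    where
    m<n*m : ∀ y n .{{_ : NonZero y}} → 1 < n → y < n * y
    m<n*m y n 1<n = subst (y <_) (*-comm y n) (m<m*n y n 1<n)
  ... | odd y          =
    step₁ y (rec (subst (y <_) (+-comm 1 (2 * y)) (s≤s (m≤n*m y 2))))

ifEven : ℕ → ℕ → ℕ → ℕ
ifEven zero          a b = a
ifEven (suc zero)    a b = b
ifEven (suc (suc n)) a b = ifEven n a b

ifEven-even : ∀ y a b → ifEven (2 * y) a b ≡ a
ifEven-even zero    a b = refl
ifEven-even (suc y) a b rewrite +-suc y (y + 0) = ifEven-even y a b

ifEven-odd : ∀ y a b → ifEven (2 * y + 1) a b ≡ b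
ifEven-odd zero    a b = refl
ifEven-odd (suc y) a b rewrite +-suc y (y + 0) = ifEven-odd y a b

⌊2*n/2⌋ : ∀ n → ⌊ 2 * n /2⌋ ≡ n
⌊2*n/2⌋ zero    = refl
⌊2*n/2⌋ (suc n) rewrite +-suc n (n + 0) = cong suc (⌊2*n/2⌋ n)

⌊2*n+1/2⌋ : ∀ n → ⌊ 2 * n + 1 /2⌋ ≡ n
⌊2*n+1/2⌋ zero    = refl
⌊2*n+1/2⌋ (suc n) rewrite +-suc n (n + 0) = cong suc (⌊2*n+1/2⌋ n)

∣⌊n/2⌋∣ : ∀ n → ∣ ⌊ n /2⌋ ∣ ≡ pred ∣ n ∣
∣⌊n/2⌋∣ n with halving n
... | even zero      = refl
... | even y@(suc _) = trans (cong ∣_∣ (⌊2*n/2⌋ y)) (cong pred (sym (∣2*n∣ y (s≤s z≤n))))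
... | odd y          = trans (cong ∣_∣ (⌊2*n+1/2⌋ y)) (cong pred (sym (∣2*n+1∣ y)))

-- A working presentation of the class, with a single function argument.

Fun : ℕ → Set
Fun n = (ℕ → ℕ) → Vec ℕ n → ℕ

-- One oracle is fixed and the recursion argument stands in front; `substitute` together with `var`
-- takes over from composition, expansion and reordering. The simulation `guard` is an induction
-- over these clauses.
data Feasible : ∀ {n} → Fun n → Set where
  zero     : Feasible {n} (λ f xs → 0)
  double   : ∀ {φ : Fun n} → Feasible φ → Feasible (λ f xs → 2 * φ f xs)
  double+1 : ∀ {φ : Fun n} → Feasible φ → Feasible (λ f xs → 2 * φ f xs + 1)
  var : (i : Fin n) → Feasible (λ f xs → lookup xs i)
  sharp    : ∀ {φ ψ : Fun n} → Feasible φ → Feasible ψ →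
             Feasible (λ f xs → φ f xs # ψ f xs)
  query    : ∀ {φ : Fun n} → Feasible φ → Feasible (λ f xs → f (φ f xs))
  substitute :
    ∀ {φ : Fun m} {γ : (ℕ → ℕ) → Vec ℕ n → Vec ℕ m} →
    Feasible φ → (∀ i → Feasible (λ f xs → lookup (γ f xs) i)) →
    Feasible (λ f xs → φ f (γ f xs))
  recursion :
    ∀ {φ κ : Fun (suc n)} {γ : Fun n} {η₀ η₁ : Fun (suc (suc n))} →
    Feasible γ → Feasible η₀ → Feasible η₁ → Feasible κ →
    (∀ f xs → φ f (0 ∷ xs) ≡ γ f xs) →
    (∀ f xs y → y > 0 → φ f (2 * y ∷ xs) ≡ η₀ f (φ f (y ∷ xs) ∷ y ∷ xs)) →
    (∀ f xs y → φ f (2 * y + 1 ∷ xs) ≡ η₁ f (φ f (y ∷ xs) ∷ y ∷ xs)) →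
    (∀ f xs y → ∣ φ f (y ∷ xs) ∣ ≤ ∣ κ f (y ∷ xs) ∣) →
    Feasible φ
  respects : ∀ {φ ψ : Fun n} → Feasible φ → (∀ f xs → ψ f xs ≡ φ f xs) → Feasible ψ

record FeasibleMap (γ : (ℕ → ℕ) → Vec ℕ n → Vec ℕ m) : Set where
  constructor components
  field component : ∀ i → Feasible (λ f xs → lookup (γ f xs) i)

open FeasibleMap

compose : ∀ {φ : Fun m} {γ : (ℕ → ℕ) → Vec ℕ n → Vec ℕ m} →
          Feasible φ → FeasibleMap γ → Feasible (λ f xs → φ f (γ f xs))
compose Φ Γ = substitute Φ (component Γ)

compose-map : ∀ {γ : (ℕ → ℕ) → Vec ℕ m → Vec ℕ l} {δ : (ℕ → ℕ) → Vec ℕ n → Vec ℕ m} →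
              FeasibleMap γ → FeasibleMap δ → FeasibleMap (λ f xs → γ f (δ f xs))
compose-map Γ Δ .component i = compose (component Γ i) Δ

identity-map : FeasibleMap {n} (λ f xs → xs)
identity-map = components var

[]-map : FeasibleMap {n} (λ f xs → [])
[]-map = components (λ ())

infixr 5 _∷-map_
_∷-map_ : ∀ {φ : Fun n} {γ : (ℕ → ℕ) → Vec ℕ n → Vec ℕ m} →
          Feasible φ → FeasibleMap γ → FeasibleMap (λ f xs → φ f xs ∷ γ f xs)
(Φ ∷-map Γ) .component zero    = Φ
(Φ ∷-map Γ) .component (suc i) = component Γ i

tabulate-map : ∀ {φ : Fin m → Fun n} → (∀ i → Feasible (φ i)) →
               FeasibleMap (λ f xs → tabulate (λ i → φ i f xs))
tabulate-map Φ .component i = respects (Φ i) (λ f xs → lookup∘tabulate _ i)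

head-feasible : Feasible {suc n} (λ f xs → head xs)
head-feasible = respects (var zero) (λ { f (x ∷ xs) → refl })

tail-map : FeasibleMap {suc n} (λ f xs → tail xs)
tail-map .component i = respects (var (suc i)) (λ { f (x ∷ xs) → refl })

++-map : ∀ {γ : (ℕ → ℕ) → Vec ℕ n → Vec ℕ l} {δ : (ℕ → ℕ) → Vec ℕ n → Vec ℕ m} →
         FeasibleMap γ → FeasibleMap δ → FeasibleMap (λ f xs → γ f xs ++ δ f xs)
++-map {l = l} {m = m} {γ = γ} {δ = δ} Γ Δ .component i
  with splitAt l i | Fin.join-splitAt l m i
... | inj₁ j | refl =
      respects (component Γ j) (λ f xs → lookup-++ˡ (γ f xs) (δ f xs) j)
... | inj₂ j | refl =
      respects (component Δ j) (λ f xs → lookup-++ʳ (γ f xs) (δ f xs) j)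

lookup-∷ʳ-inject₁ : ∀ {A : Set} (xs : Vec A n) x i → lookup (xs ∷ʳ x) (inject₁ i) ≡ lookup xs i
lookup-∷ʳ-inject₁ (x ∷ xs) y zero    = refl
lookup-∷ʳ-inject₁ (x ∷ xs) y (suc i) = lookup-∷ʳ-inject₁ xs y i

lookup-∷ʳ-fromℕ : ∀ {A : Set} (xs : Vec A n) x → lookup (xs ∷ʳ x) (fromℕ n) ≡ x
lookup-∷ʳ-fromℕ []       y = refl
lookup-∷ʳ-fromℕ (x ∷ xs) y = lookup-∷ʳ-fromℕ xs y

∷ʳ-map : ∀ {φ : Fun n} {γ : (ℕ → ℕ) → Vec ℕ n → Vec ℕ m} →
         FeasibleMap γ → Feasible φ → FeasibleMap (λ f xs → γ f xs ∷ʳ φ f xs)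
∷ʳ-map {φ = φ} {γ} Γ Φ .component i with view i
... | ‵fromℕ     = respects Φ (λ f xs → lookup-∷ʳ-fromℕ (γ f xs) (φ f xs))
... | ‵inject₁ j = respects (component Γ j) (λ f xs → lookup-∷ʳ-inject₁ (γ f xs) (φ f xs) j)

lookup-take : ∀ {A : Set} m (xs : Vec A (m + n)) i → lookup (take m xs) i ≡ lookup xs (i ↑ˡ n)
lookup-take (suc m) (x ∷ xs) zero    = refl
lookup-take (suc m) (x ∷ xs) (suc i) = lookup-take m xs i

lookup-drop : ∀ {A : Set} m (xs : Vec A (m + n)) i → lookup (drop m xs) i ≡ lookup xs (m ↑ʳ i)
lookup-drop zero    xs       i = refl
lookup-drop (suc m) (x ∷ xs) i = lookup-drop m xs i

take-map : ∀ m → FeasibleMap {m + n} (λ f xs → take m xs)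
take-map {n = n} m .component i = respects (var (i ↑ˡ n)) (λ f xs → lookup-take m xs i)

drop-map : ∀ m → FeasibleMap {m + n} (λ f xs → drop m xs)
drop-map m .component i = respects (var (m ↑ʳ i)) (λ f xs → lookup-drop m xs i)

weaken : ∀ m {φ : Fun n} → Feasible φ → Feasible (λ f xs → φ f (drop m xs))
weaken m Φ = compose Φ (drop-map m)

take-++ : ∀ {A : Set} (xs : Vec A m) (ys : Vec A n) → take m (xs ++ ys) ≡ xs
take-++ []       ys = refl
take-++ (x ∷ xs) ys = cong (x ∷_) (take-++ xs ys)

drop-++ : ∀ {A : Set} (xs : Vec A m) (ys : Vec A n) → drop m (xs ++ ys) ≡ ys
drop-++ []       ys = refl
drop-++ (x ∷ xs) ys = drop-++ xs ys

-- From `BFF` to `Feasible`.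

-- Mediates between `limitedRecursion`, which recurses on the last argument, and `recursion`, which
-- recurses on the first.
rotate : ∀ {A : Set} → Vec A (suc n) → Vec A (suc n)
rotate {n} xs = lookup xs (fromℕ n) ∷ tabulate (lookup xs ∘ inject₁)

rotate-∷ʳ : ∀ {A : Set} (xs : Vec A n) y → rotate (xs ∷ʳ y) ≡ y ∷ xs
rotate-∷ʳ xs y = cong₂ _∷_ (lookup-∷ʳ-fromℕ xs y)
  (trans (tabulate-cong (lookup-∷ʳ-inject₁ xs y)) (tabulate∘lookup xs))

rotate⁻¹ : ∀ {A : Set} → Vec A (suc n) → Vec A (suc n)
rotate⁻¹ xs = tail xs ∷ʳ head xs

rotate⁻¹∘rotate : ∀ {A : Set} (xs : Vec A (suc n)) → rotate⁻¹ (rotate xs) ≡ xs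
rotate⁻¹∘rotate {zero}  (x ∷ [])     = refl
rotate⁻¹∘rotate {suc n} (x ∷ xs@(_ ∷ _)) = cong (x ∷_) (rotate⁻¹∘rotate xs)

rotate-map : FeasibleMap {suc n} (λ f xs → rotate xs)
rotate-map {n} = var (fromℕ n) ∷-map tabulate-map (λ i → var (inject₁ i))

rotate⁻¹-map : FeasibleMap {suc n} (λ f xs → rotate⁻¹ xs)
rotate⁻¹-map = ∷ʳ-map tail-map head-feasible

replicate-++ : ∀ {A : Set} k {k′} {x : A} → replicate (k + k′) x ≡ replicate k x ++ replicate k′ x
replicate-++ zero    = refl
replicate-++ (suc k) = cong (_ ∷_) (replicate-++ k)

permute-replicate : ∀ {A : Set} (π : Permutation′ k) (x : A) →
                    permute π (replicate k x) ≡ replicate k x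
permute-replicate {k} π x = trans
  (tabulate-cong (λ i → trans (lookup-replicate (π ⟨$⟩ʳ i) x) (sym (lookup-replicate i x))))
  (tabulate∘lookup (replicate k x))

-- Initial functionals have `k = 0` or `k = 1` and `expansion` adds function arguments, so an
-- induction over `BFF` meets every `k`. Feeding the same `f` to all places turns each functional
-- into a `Fun` and loses nothing at `k = 1`.
diagonal : Functional k l → Fun l
diagonal {k} F f xs = F (replicate k f) xs

BFF⇒Feasible : ∀ {F : Functional k l} → BFF F → Feasible (diagonal F)
BFF⇒Feasible zeroᶠ    = respects zero (λ { f (x ∷ []) → refl })
BFF⇒Feasible double   = respects (double (var zero)) (λ { f (x ∷ []) → refl })
BFF⇒Feasible double+1 = respects (double+1 (var zero)) (λ { f (x ∷ []) → refl })
BFF⇒Feasible (projection i) = var i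
BFF⇒Feasible smashᶠ   = respects (sharp (var zero) (var (suc zero))) (λ { f (x ∷ y ∷ []) → refl })
BFF⇒Feasible apply    = respects (query (var zero)) (λ { f (x ∷ []) → refl })
BFF⇒Feasible (composition H Gs F≡) =
  respects
    (compose (BFF⇒Feasible H)
      (++-map (tabulate-map (λ i → BFF⇒Feasible (Gs i))) identity-map))
    (λ f xs → F≡ _ xs)
BFF⇒Feasible (expansion {k = k} {k′} {l} {l′} {F = F} {G} Gᶠ F≡) =
  respects (compose (BFF⇒Feasible Gᶠ) (take-map l)) λ f xs →
    trans (cong₂ F (replicate-++ k) (sym (take++drop≡id l xs)))
          (F≡ (replicate k f) (replicate k′ f) (take l xs) (drop l xs))
BFF⇒Feasible (reordering {G = G} π ρ Gᶠ F≡) =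
  respects (compose (BFF⇒Feasible Gᶠ) (tabulate-map (λ i → var (ρ ⟨$⟩ʳ i)))) λ f xs →
    trans (F≡ _ xs) (cong (λ fs → G fs (permute ρ xs)) (permute-replicate π f))
BFF⇒Feasible (limitedRecursion {F = F} Gᶠ H₁ᶠ H₂ᶠ Kᶠ F-0 F-2y F-2y+1 F≤K) =
  respects
    (compose
      (recursion {φ = λ f xs → diagonal F f (rotate⁻¹ xs)}
        (BFF⇒Feasible Gᶠ)
        (compose (BFF⇒Feasible H₁ᶠ) rotate²-map)
        (compose (BFF⇒Feasible H₂ᶠ) rotate²-map)
        (compose (BFF⇒Feasible Kᶠ) rotate⁻¹-map)
        (λ f xs → F-0 _ xs)
        (λ f xs y y>0 → F-2y _ xs y y>0)
        (λ f xs y → F-2y+1 _ xs y)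
        (λ f xs y → F≤K _ xs y))
      rotate-map)
    (λ f xs → cong (diagonal F f) (sym (rotate⁻¹∘rotate xs)))
  where
  rotate²-map : FeasibleMap {suc (suc n)} (λ f xs → rotate⁻¹ (tail xs) ∷ʳ head xs)
  rotate²-map = ∷ʳ-map (compose-map rotate⁻¹-map tail-map) head-feasible

-- From `Feasible` back to `BFF`.

BFF-respects : ∀ {F G : Functional k l} → BFF G → (∀ fs xs → F fs xs ≡ G fs xs) → BFF F
BFF-respects Gᶠ F≡G = composition {G = λ ()} Gᶠ (λ ()) F≡G

-- `composition` passes the old arguments on behind the new ones; expanding `F` by these places lets
-- it disregard them.
BFF-compose :
  ∀ {F : Functional 1 m} {γ : Vec (ℕ → ℕ) 1 → Vec ℕ n → Vec ℕ m} →
  BFF F → (∀ i → BFF (λ fs xs → lookup (γ fs xs) i)) →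
  BFF (λ fs xs → F fs (γ fs xs))
BFF-compose {m} {n} {F} {γ} Fᶠ Γ =
  composition {H = λ fs xs → F fs (take m xs)}
    (expansion {k′ = 0} Fᶠ λ { (f ∷ []) [] xs ys → cong (F _) (take-++ xs ys) })
    Γ
    (λ fs xs → cong (F fs) (sym (trans (take-++ _ xs) (tabulate∘lookup (γ fs xs)))))

BFF-lookup : (i : Fin n) → BFF {1} (λ fs xs → lookup xs i)
BFF-lookup {suc n} i =
  -- Expanding `projection i` by function arguments alone would give a length of the form `m + 0`,
  -- which does not compute to `m`. The unary projection expands to `1 + n` instead, and a
  -- transposition brings place `i` to the front.
  reordering {G = λ fs xs → lookup xs zero} Permutation.id (transpose zero i)
    (expansion {k′ = 1} {l′ = n} (projection {1} zero) λ { [] gs (x ∷ []) ys → refl })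
    (λ fs xs → refl)

BFF-permute :
  ∀ {F : Functional 1 m} → BFF F → (ρ : Fin m → Fin n) →
  BFF (λ fs xs → F fs (tabulate (lookup xs ∘ ρ)))
BFF-permute Fᶠ ρ = BFF-compose Fᶠ λ i →
  BFF-respects (BFF-lookup (ρ i)) (λ fs xs → lookup∘tabulate (lookup xs ∘ ρ) i)

withDummy : Fun n → Functional 1 (suc n)
withDummy φ fs xs = φ (head fs) (tail xs)

-- No basic feasible functional has rank (1 , 0), whereas Feasible has
-- closed members; the additional first argument makes up for this.
Feasible⇒BFF : ∀ {φ : Fun n} → Feasible φ → BFF (withDummy φ)
Feasible⇒BFF zero =
  BFF-compose {F = λ fs xs → 0} {γ = λ fs xs → head xs ∷ []}
    (expansion {k′ = 1} {l′ = 0} zeroᶠ λ { [] gs (x ∷ []) [] → refl })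
    λ { zero → BFF-respects (BFF-lookup zero) (λ { fs (x ∷ xs) → refl }) }
Feasible⇒BFF (double {φ = φ} Φ) =
  BFF-compose {F = λ fs xs → 2 * head xs} {γ = λ fs xs → withDummy φ fs xs ∷ []}
    (expansion {k′ = 1} {l′ = 0} double λ { [] gs (x ∷ []) [] → refl })
    λ { zero → Feasible⇒BFF Φ }
Feasible⇒BFF (double+1 {φ = φ} Φ) =
  BFF-compose {F = λ fs xs → 2 * head xs + 1} {γ = λ fs xs → withDummy φ fs xs ∷ []}
    (expansion {k′ = 1} {l′ = 0} double+1 λ { [] gs (x ∷ []) [] → refl })
    λ { zero → Feasible⇒BFF Φ }
Feasible⇒BFF (var i) =
  BFF-respects (BFF-lookup (suc i)) (λ { fs (x ∷ xs) → refl })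
Feasible⇒BFF (sharp {φ = φ} {ψ} Φ Ψ) =
  BFF-compose {F = λ fs xs → head xs # head (tail xs)}
    {γ = λ fs xs → withDummy φ fs xs ∷ withDummy ψ fs xs ∷ []}
    (expansion {k′ = 1} {l′ = 0} smashᶠ λ { [] gs (x ∷ y ∷ []) [] → refl })
    λ { zero → Feasible⇒BFF Φ ; (suc zero) → Feasible⇒BFF Ψ }
Feasible⇒BFF (query {φ = φ} Φ) =
  BFF-compose {F = λ fs xs → head fs (head xs)} {γ = λ fs xs → withDummy φ fs xs ∷ []}
    (BFF-respects apply (λ { (f ∷ []) (x ∷ []) → refl }))
    λ { zero → Feasible⇒BFF Φ }
Feasible⇒BFF (substitute {γ = γ} Φ Γ) =
  BFF-compose {γ = λ fs xs → head xs ∷ γ (head fs) (tail xs)} (Feasible⇒BFF Φ)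
    λ { zero → BFF-respects (BFF-lookup zero) (λ { fs (x ∷ xs) → refl })
      ; (suc i) → Feasible⇒BFF (Γ i) }
Feasible⇒BFF (recursion {n} {φ = φ} {κ} {γ} {η₀} {η₁} Γ H₀ H₁ Κ φ-0 φ-2y φ-2y+1 φ≤κ) =
  BFF-respects
    -- `withDummy φ` recurses on the argument after the dummy, but `limitedRecursion` needs it last.
    -- So the recursion is built for `F`, and this substitution restores the order.
    (BFF-compose {γ = λ fs us → (head us ∷ tail (tail us)) ∷ʳ head (tail us)}
      (limitedRecursion {F = F}
        (Feasible⇒BFF Γ)
        (BFF-permute (Feasible⇒BFF H₀) ρ²)
        (BFF-permute (Feasible⇒BFF H₁) ρ²)
        (BFF-permute (Feasible⇒BFF Κ) ρ)
        (λ { fs (d ∷ xs) → trans (F-∷ʳ fs d xs 0) (φ-0 (head fs) xs) })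
        (λ { fs (d ∷ xs) y y>0 → begin
          F fs ((d ∷ xs) ∷ʳ 2 * y)                               ≡⟨ F-∷ʳ fs d xs (2 * y) ⟩
          φ (head fs) (2 * y ∷ xs)                               ≡⟨ φ-2y (head fs) xs y y>0 ⟩
          η₀ (head fs) (φ (head fs) (y ∷ xs) ∷ y ∷ xs)           ≡⟨ step-∷ʳ η₀ fs d xs y ⟨
          _                                                      ∎ })
        (λ { fs (d ∷ xs) y → begin
          F fs ((d ∷ xs) ∷ʳ 2 * y + 1)                           ≡⟨ F-∷ʳ fs d xs (2 * y + 1) ⟩
          φ (head fs) (2 * y + 1 ∷ xs)                           ≡⟨ φ-2y+1 (head fs) xs y ⟩
          η₁ (head fs) (φ (head fs) (y ∷ xs) ∷ y ∷ xs)           ≡⟨ step-∷ʳ η₁ fs d xs y ⟨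
          _                                                      ∎ })
        (λ { fs (d ∷ xs) y → subst₂ _≤_
          (cong ∣_∣ (sym (F-∷ʳ fs d xs y)))
          (cong (λ us → ∣ withDummy κ fs us ∣) (sym (permute-ρ d xs y)))
          (φ≤κ (head fs) xs y) }))
      (λ i → unsnoc i (view i)))
    λ { fs (d ∷ y ∷ xs) → sym (F-∷ʳ fs d xs y) }
  where
  open ≡-Reasoning

  ρ : Fin (2 + n) → Fin (2 + n)
  ρ zero          = zero
  ρ (suc zero)    = fromℕ _
  ρ (suc (suc i)) = inject₁ (suc i)

  permute-ρ : ∀ d (xs : Vec ℕ n) y → tabulate (lookup ((d ∷ xs) ∷ʳ y) ∘ ρ) ≡ d ∷ y ∷ xs
  permute-ρ d xs y = cong (d ∷_) (rotate-∷ʳ xs y)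

  ρ² : Fin (3 + n) → Fin (3 + n)
  ρ² zero                = zero
  ρ² (suc zero)          = fromℕ _
  ρ² (suc (suc zero))    = inject₁ (fromℕ _)
  ρ² (suc (suc (suc i))) = inject₁ (inject₁ (suc i))

  permute-ρ² : ∀ d (xs : Vec ℕ n) y v →
               tabulate (lookup ((d ∷ xs) ∷ʳ y ∷ʳ v) ∘ ρ²) ≡ d ∷ v ∷ y ∷ xs
  permute-ρ² d xs y v = cong (d ∷_) (cong₂ _∷_ (lookup-∷ʳ-fromℕ (xs ∷ʳ y) v)
    (trans
      (cong₂ _∷_
        (lookup-∷ʳ-inject₁ (xs ∷ʳ y) v (fromℕ n))
        (tabulate-cong (λ i → lookup-∷ʳ-inject₁ (xs ∷ʳ y) v (inject₁ i))))
      (rotate-∷ʳ xs y)))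

  F : Functional 1 (2 + n)
  F fs us = withDummy φ fs (tabulate (lookup us ∘ ρ))

  F-∷ʳ : ∀ fs d xs y → F fs ((d ∷ xs) ∷ʳ y) ≡ φ (head fs) (y ∷ xs)
  F-∷ʳ fs d xs y = cong (withDummy φ fs) (permute-ρ d xs y)

  step-∷ʳ : ∀ (η : Fun (2 + n)) fs d xs y →
            withDummy η fs (tabulate (lookup ((d ∷ xs) ∷ʳ y ∷ʳ F fs ((d ∷ xs) ∷ʳ y)) ∘ ρ²)) ≡
            η (head fs) (φ (head fs) (y ∷ xs) ∷ y ∷ xs)
  step-∷ʳ η fs d xs y = trans
    (cong (withDummy η fs) (permute-ρ² d xs y _))
    (cong (λ v → η (head fs) (v ∷ y ∷ xs)) (F-∷ʳ fs d xs y))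

  unsnoc : ∀ i → View i → BFF {1} {2 + n} (λ fs us →
    lookup ((head us ∷ tail (tail us)) ∷ʳ head (tail us)) i)
  unsnoc _ ‵fromℕ = BFF-respects (BFF-lookup (suc zero))
    (λ { fs (d ∷ y ∷ xs) → lookup-∷ʳ-fromℕ (d ∷ xs) y })
  unsnoc _ (‵inject₁ zero) = BFF-respects (BFF-lookup zero)
    (λ { fs (d ∷ y ∷ xs) → lookup-∷ʳ-inject₁ (d ∷ xs) y zero })
  unsnoc _ (‵inject₁ (suc i)) = BFF-respects (BFF-lookup (suc (suc i)))
    (λ { fs (d ∷ y ∷ xs) → lookup-∷ʳ-inject₁ (d ∷ xs) y (suc i) })
Feasible⇒BFF (respects Φ ψ≡φ) =
  BFF-respects (Feasible⇒BFF Φ) (λ fs xs → ψ≡φ (head fs) (tail xs))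

-- Feasible case distinction, iteration and comparison of lengths.

-- The smash of `2 * m + 1` and `2 * n + 1` has length `suc (suc ∣ m ∣ * suc ∣ n ∣)` and thus serves
-- as an upper bound of both lengths. The appended digits keep the product from vanishing when `m`
-- or `n` is 0.
∣m∣≤∣2*m+1#2*n+1∣ : ∀ m n → ∣ m ∣ ≤ ∣ (2 * m + 1) # (2 * n + 1) ∣
∣m∣≤∣2*m+1#2*n+1∣ m n rewrite ∣#∣ (2 * m + 1) (2 * n + 1) | ∣2*n+1∣ m | ∣2*n+1∣ n =
  ≤-trans (n≤1+n _) (≤-trans (m≤m*n (suc ∣ m ∣) (suc ∣ n ∣)) (n≤1+n _))

∣n∣≤∣2*m+1#2*n+1∣ : ∀ m n → ∣ n ∣ ≤ ∣ (2 * m + 1) # (2 * n + 1) ∣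
∣n∣≤∣2*m+1#2*n+1∣ m n rewrite ∣#∣ (2 * m + 1) (2 * n + 1) | ∣2*n+1∣ m | ∣2*n+1∣ n =
  ≤-trans (n≤1+n _) (≤-trans (m≤n*m (suc ∣ n ∣) (suc ∣ m ∣)) (n≤1+n _))

infix 8 _⊔ᶠ_
_⊔ᶠ_ : ∀ {φ ψ : Fun n} → Feasible φ → Feasible ψ →
      Feasible (λ f xs → (2 * φ f xs + 1) # (2 * ψ f xs + 1))
Φ ⊔ᶠ Ψ = sharp (double+1 Φ) (double+1 Ψ)

half : ∀ {φ : Fun n} → Feasible φ → Feasible (λ f xs → ⌊ φ f xs /2⌋)
half Φ = compose
  (recursion {φ = λ f xs → ⌊ lookup xs zero /2⌋} {η₀ = λ f xs → lookup xs (suc zero)}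
    zero (var (suc zero)) (var (suc zero)) (var {1} zero)
    (λ f xs → refl)
    (λ f xs y _ → ⌊2*n/2⌋ y)
    (λ f xs y → ⌊2*n+1/2⌋ y)
    (λ f xs y → ∣∣-mono-≤ (⌊n/2⌋≤n y)))
  (Φ ∷-map []-map)

ifZero : ℕ → ℕ → ℕ → ℕ
ifZero zero    a b = a
ifZero (suc _) a b = b

ifZero-feasible : ∀ {χ φ ψ : Fun n} → Feasible χ → Feasible φ → Feasible ψ →
                  Feasible (λ f xs → ifZero (χ f xs) (φ f xs) (ψ f xs))
ifZero-feasible Χ Φ Ψ = compose
  (recursion
    {φ = λ f xs → ifZero (lookup xs zero) (lookup xs (suc zero)) (lookup xs (suc (suc zero)))}
    (var zero) (var (suc (suc (suc zero)))) (var (suc (suc (suc zero))))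
    (var {3} (suc zero) ⊔ᶠ var (suc (suc zero)))
    (λ f xs → refl)
    (λ { f xs (suc y) _ → refl })
    (λ f xs y → cong (λ c → ifZero c (lookup xs zero) (lookup xs (suc zero))) (+-comm (2 * y) 1))
    (λ { f (a ∷ b ∷ []) zero    → ∣m∣≤∣2*m+1#2*n+1∣ a b
       ; f (a ∷ b ∷ []) (suc y) → ∣n∣≤∣2*m+1#2*n+1∣ a b }))
  (Χ ∷-map Φ ∷-map Ψ ∷-map []-map)

ifEven-feasible : ∀ {χ φ ψ : Fun n} → Feasible χ → Feasible φ → Feasible ψ →
                  Feasible (λ f xs → ifEven (χ f xs) (φ f xs) (ψ f xs))
ifEven-feasible Χ Φ Ψ = compose
  (recursion
    {φ = λ f xs → ifEven (lookup xs zero) (lookup xs (suc zero)) (lookup xs (suc (suc zero)))}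
    (var zero) (var (suc (suc zero))) (var (suc (suc (suc zero))))
    (var {3} (suc zero) ⊔ᶠ var (suc (suc zero)))
    (λ f xs → refl)
    (λ f xs y _ → ifEven-even y _ _)
    (λ f xs y → ifEven-odd y _ _)
    (λ { f (a ∷ b ∷ []) y → bound y a b }))
  (Χ ∷-map Φ ∷-map Ψ ∷-map []-map)
  where
  bound : ∀ y a b → ∣ ifEven y a b ∣ ≤ ∣ (2 * a + 1) # (2 * b + 1) ∣
  bound zero          a b = ∣m∣≤∣2*m+1#2*n+1∣ a b
  bound (suc zero)    a b = ∣n∣≤∣2*m+1#2*n+1∣ a b
  bound (suc (suc y)) a b = bound y a b

suc-feasible : ∀ {φ : Fun n} → Feasible φ → Feasible (λ f xs → suc (φ f xs))
suc-feasible Φ = compose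
  (recursion {φ = λ f xs → suc (lookup xs zero)}
    (double+1 zero) (double+1 (var (suc zero))) (double (var zero)) (double+1 (var {1} zero))
    (λ f xs → refl)
    (λ f xs y _ → +-comm 1 (2 * y))
    (λ f xs y → trans (cong suc (+-comm (2 * y) 1)) (sym (*-suc 2 y)))
    (λ f xs y → ∣∣-mono-≤ (subst (suc y ≤_) (+-comm 1 (2 * y)) (s≤s (m≤n*m y 2)))))
  (Φ ∷-map []-map)

length-feasible : ∀ {φ : Fun n} → Feasible φ → Feasible (λ f xs → ∣ φ f xs ∣)
length-feasible Φ = compose
  (recursion {φ = λ f xs → ∣ lookup xs zero ∣}
    zero (suc-feasible (var zero)) (suc-feasible (var zero)) (var {1} zero)
    (λ f xs → refl)
    (λ f xs y → ∣2*n∣ y)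
    (λ f xs y → ∣2*n+1∣ y)
    (λ f xs y → ∣∣-mono-≤ (∣n∣≤n y)))
  (Φ ∷-map []-map)

iterate : (ℕ → ℕ → ℕ) → ℕ → ℕ → ℕ
iterate h a zero    = a
iterate h a (suc t) = h t (iterate h a t)

-- Recursion on notation makes one step per digit, hence the count `∣ τ f xs ∣`. The bound is
-- required for every `t`, not only up to this count, because the underlying limited recursion must
-- be bounded for all values of its recursion argument.
iterate-feasible :
  ∀ {α κ τ : Fun n} {η : Fun (2 + n)} →
  Feasible α → Feasible η → Feasible κ → Feasible τ →
  (∀ f xs t → ∣ iterate (λ t s → η f (s ∷ t ∷ xs)) (α f xs) t ∣ ≤ ∣ κ f xs ∣) →
  Feasible (λ f xs → iterate (λ t s → η f (s ∷ t ∷ xs)) (α f xs) ∣ τ f xs ∣)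
iterate-feasible {n} {α} {κ} {τ} {η} Α Η Κ Τ bounded = compose
  (recursion
    {φ = λ f xs → iterate (λ t s → η f (s ∷ t ∷ tail xs)) (α f (tail xs)) ∣ head xs ∣}
    Α step step (compose Κ (tail-map))
    (λ f xs → refl)
    (λ f xs y y>0 → cong (iterate _ _) (∣2*n∣ y y>0))
    (λ f xs y → cong (iterate _ _) (∣2*n+1∣ y))
    (λ f xs y → bounded f xs ∣ y ∣))
  (Τ ∷-map identity-map)
  where
  step : Feasible {2 + n} (λ f xs → η f (head xs ∷ ∣ head (tail xs) ∣ ∷ tail (tail xs)))
  step = compose Η
    (head-feasible ∷-map length-feasible (compose head-feasible tail-map) ∷-map
     compose-map tail-map tail-map)

infixl 7 _≫_
-- A right shift by `∣ y ∣` places, meant for comparing lengths: it yields 0 exactly when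
-- `∣ x ∣ ≤ ∣ y ∣`.
_≫_ : ℕ → ℕ → ℕ
x ≫ y = iterate (λ _ → ⌊_/2⌋) x ∣ y ∣

∣iterate-half∣ : ∀ x t → ∣ iterate (λ _ → ⌊_/2⌋) x t ∣ ≡ ∣ x ∣ ∸ t
∣iterate-half∣ x zero    = refl
∣iterate-half∣ x (suc t) = begin
  ∣ ⌊ iterate (λ _ → ⌊_/2⌋) x t /2⌋ ∣    ≡⟨ ∣⌊n/2⌋∣ (iterate (λ _ → ⌊_/2⌋) x t) ⟩
  pred ∣ iterate (λ _ → ⌊_/2⌋) x t ∣     ≡⟨ cong pred (∣iterate-half∣ x t) ⟩
  pred (∣ x ∣ ∸ t)                       ≡⟨ pred[m∸n]≡m∸[1+n] ∣ x ∣ t ⟩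
  ∣ x ∣ ∸ suc t                          ∎
  where open ≡-Reasoning

≫-feasible : ∀ {φ ψ : Fun n} → Feasible φ → Feasible ψ →
             Feasible (λ f xs → φ f xs ≫ ψ f xs)
≫-feasible {φ = φ} {ψ} Φ Ψ =
  iterate-feasible {η = λ f xs → ⌊ head xs /2⌋} Φ (half head-feasible) Φ Ψ
    (λ f xs t → ≤-trans (≤-reflexive (∣iterate-half∣ (φ f xs) t)) (m∸n≤m _ t))

flag : ∀ {P : Set} → Dec P → ℕ
flag (yes _) = 1
flag (no _)  = 0

flag-×-dec : ∀ {P Q : Set} (p? : Dec P) (q? : Dec Q) →
             flag (p? ×-dec q?) ≡ ifZero (flag p?) 0 (flag q?)
flag-×-dec (yes p) (yes q) = refl
flag-×-dec (yes p) (no ¬q) = refl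
flag-×-dec (no ¬p) q?      = refl

flag-⊎-dec : ∀ {P Q : Set} (p? : Dec P) (q? : Dec Q) →
             flag (p? ⊎-dec q?) ≡ ifZero (flag p?) (flag q?) 1
flag-⊎-dec (yes p) q?      = refl
flag-⊎-dec (no ¬p) (yes q) = refl
flag-⊎-dec (no ¬p) (no ¬q) = refl

flag-≤ : ∀ x y (p? : Dec (∣ x ∣ ≤ ∣ y ∣)) → flag p? ≡ ifZero (x ≫ y) 1 0
flag-≤ x y (yes ∣x∣≤∣y∣) = cong (λ c → ifZero c 1 0) (sym x≫y≡0)
  where
  x≫y≡0 : x ≫ y ≡ 0
  x≫y≡0 = ∣n∣≡0⇒n≡0 _ (trans (∣iterate-half∣ x ∣ y ∣) (m≤n⇒m∸n≡0 ∣x∣≤∣y∣))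
flag-≤ x y (no ∣x∣≰∣y∣) with x ≫ y | ∣iterate-half∣ x ∣ y ∣
... | zero  | 0≡∣x∣∸∣y∣ = contradiction (m∸n≡0⇒m≤n (sym 0≡∣x∣∸∣y∣)) ∣x∣≰∣y∣
... | suc _ | _         = refl

∣∣≤?-feasible : ∀ {φ ψ : Fun n} → Feasible φ → Feasible ψ →
                Feasible (λ f xs → flag (∣ φ f xs ∣ ≤? ∣ ψ f xs ∣))
∣∣≤?-feasible {φ = φ} {ψ} Φ Ψ = respects
  (ifZero-feasible (≫-feasible Φ Ψ) (double+1 zero) zero)
  (λ f xs → flag-≤ (φ f xs) (ψ f xs) _)

flag-<? : ∀ x y (p? : Dec (∣ x ∣ < ∣ y ∣)) (q? : Dec (∣ y ∣ ≤ ∣ x ∣)) →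
          flag p? ≡ ifZero (flag q?) 1 0
flag-<? x y (yes p) (yes q) = contradiction q (<⇒≱ p)
flag-<? x y (yes p) (no ¬q) = refl
flag-<? x y (no ¬p) (yes q) = refl
flag-<? x y (no ¬p) (no ¬q) = contradiction (≰⇒> ¬q) ¬p

∣∣<?-feasible : ∀ {φ ψ : Fun n} → Feasible φ → Feasible ψ →
                Feasible (λ f xs → flag (∣ φ f xs ∣ <? ∣ ψ f xs ∣))
∣∣<?-feasible {φ = φ} {ψ} Φ Ψ = respects
  (ifZero-feasible (∣∣≤?-feasible Ψ Φ) (double+1 zero) zero)
  (λ f xs → flag-<? (φ f xs) (ψ f xs) _ (∣ ψ f xs ∣ ≤? ∣ φ f xs ∣))

×-dec-feasible : ∀ {P Q : (ℕ → ℕ) → Vec ℕ n → Set}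
                 {P? : ∀ f xs → Dec (P f xs)} {Q? : ∀ f xs → Dec (Q f xs)} →
                 Feasible (λ f xs → flag (P? f xs)) → Feasible (λ f xs → flag (Q? f xs)) →
                 Feasible (λ f xs → flag (P? f xs ×-dec Q? f xs))
×-dec-feasible {P? = P?} {Q?} Pᶠ Qᶠ =
  respects (ifZero-feasible Pᶠ zero Qᶠ) (λ f xs → flag-×-dec (P? f xs) (Q? f xs))

⊎-dec-feasible : ∀ {P Q : (ℕ → ℕ) → Vec ℕ n → Set}
                 {P? : ∀ f xs → Dec (P f xs)} {Q? : ∀ f xs → Dec (Q f xs)} →
                 Feasible (λ f xs → flag (P? f xs)) → Feasible (λ f xs → flag (Q? f xs)) →
                 Feasible (λ f xs → flag (P? f xs ⊎-dec Q? f xs))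
⊎-dec-feasible {P? = P?} {Q?} Pᶠ Qᶠ =
  respects (ifZero-feasible Pᶠ Qᶠ (double+1 zero)) (λ f xs → flag-⊎-dec (P? f xs) (Q? f xs))

-- Guarded runs, which abort at a forbidden query.

module _ (a : ℕ) (h₀ h₁ : ℕ → ℕ → ℕ) where

  -- `recursion` certifies a function that is already given with its equations. The guarded
  -- recursion has no such function yet, and recursion over the digits constructs it.
  digitRec : Expansion 2 → ℕ
  digitRec []              = a
  digitRec (zero ∷ ds)     = h₀ (fromDigits ds) (digitRec ds)
  digitRec (suc zero ∷ ds) = h₁ (fromDigits ds) (digitRec ds)

  binaryRec : ℕ → ℕ
  binaryRec y = digitRec (binary y)

  binaryRec-2y : ∀ y → y > 0 → binaryRec (2 * y) ≡ h₀ y (binaryRec y)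
  binaryRec-2y (suc y) _ = trans (cong digitRec (binary-double-suc y))
    (cong (λ x → h₀ x (binaryRec (suc y))) (fromDigits-binary (suc y)))

  binaryRec-2y+1 : ∀ y → binaryRec (2 * y + 1) ≡ h₁ y (binaryRec y)
  binaryRec-2y+1 y rewrite +-comm (2 * y) 1 = trans (cong digitRec (binary-double+1 y))
    (cong (λ x → h₁ x (binaryRec y)) (fromDigits-binary y))

-- Collects the runs of the arguments of a substitution. The default 0 is even and therefore signals
-- that none of them has aborted.
firstOdd : (Fin k → ℕ) → ℕ
firstOdd {zero}  r = 0
firstOdd {suc k} r = ifEven (r zero) (firstOdd (r ∘ suc)) (r zero)

firstOdd-feasible : ∀ {r : Fin k → Fun n} → (∀ i → Feasible (r i)) →
                    Feasible (λ f xs → firstOdd (λ i → r i f xs))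
firstOdd-feasible {zero}  R = zero
firstOdd-feasible {suc k} R =
  ifEven-feasible (R zero) (firstOdd-feasible (λ i → R (suc i))) (R zero)

module Guarded
  {m} (V : (ℕ → ℕ) → Vec ℕ m → ℕ → Set)
  (V? : ∀ f zs y → Dec (V f zs y))
  (V?-feasible : Feasible (λ f ys → flag (V? f (tail ys) (head ys))))
  (bound : Fun m) (bound-feasible : Feasible bound)
  (V-bounded : ∀ f zs y → V f zs y → ∣ y ∣ ≤ ∣ bound f zs ∣)
  where

  -- A returned value has to be correct for all these `g` at once. Two instances matter: `f` itself,
  -- and the truncation of `f`.
  Agree : (f g : ℕ → ℕ) → Vec ℕ m → Set
  Agree f g zs = ∀ y → ¬ V f zs y → g y ≡ f y

  -- A result 2 * v encodes the value v, and 2 * y + 1 an abort at the query y.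
  data Run (f : ℕ → ℕ) (zs : Vec ℕ m) (val : (ℕ → ℕ) → ℕ) : ℕ → Set where
    returns : ∀ v → (∀ g → Agree f g zs → val g ≡ v) → Run f zs val (2 * v)
    aborts  : ∀ y → V f zs y → Run f zs val (2 * y + 1)

  run-map : ∀ {f zs val val′ r} → (∀ g → Agree f g zs → val′ g ≡ val g) →
            Run f zs val r → Run f zs val′ r
  run-map val′≡val (returns v val≡v) =
    returns v (λ g f~g → trans (val′≡val g f~g) (val≡v g f~g))
  run-map val′≡val (aborts y Vy) = aborts y Vy

  run-bind : ∀ {f zs val val′ r} (k : ℕ → ℕ) → Run f zs val r →
             (∀ v → (∀ g → Agree f g zs → val g ≡ v) → Run f zs val′ (k v)) →
             Run f zs val′ (ifEven r (k ⌊ r /2⌋) r)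
  run-bind k (returns v val≡v) next
    rewrite ifEven-even v (k ⌊ 2 * v /2⌋) (2 * v) | ⌊2*n/2⌋ v = next v val≡v
  run-bind k (aborts y Vy) next
    rewrite ifEven-odd y (k ⌊ 2 * y + 1 /2⌋) (2 * y + 1) = aborts y Vy

  -- The inner `2 * _ + 1` pays for the digit by which values and queries are encoded, the outer one
  -- belongs to the upper bound of two lengths.
  runBound : ℕ → ℕ → ℕ
  runBound a b = (2 * (2 * a + 1) + 1) # (2 * (2 * b + 1) + 1)

  runBound-feasible : ∀ {κ λ′ : Fun n} → Feasible κ → Feasible λ′ →
                      Feasible (λ f xs → runBound (κ f xs) (λ′ f xs))
  runBound-feasible Κ Λ = double+1 Κ ⊔ᶠ double+1 Λ

  -- A returned value is the value at every agreeing `g`, so it suffices to bound the functional at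
  -- one `g` of choice, even though the run queries `f`.
  run-bounded : ∀ {f g zs val r} a → Run f zs val r → Agree f g zs →
                ∣ val g ∣ ≤ ∣ a ∣ → ∣ r ∣ ≤ ∣ runBound a (bound f zs) ∣
  run-bounded {f} {g} {zs} a (returns v val≡v) f~g val≤a = begin
    ∣ 2 * v ∣                     ≤⟨ ∣2*n∣≤suc v ⟩
    suc ∣ v ∣                     ≤⟨ s≤s (subst (λ v → ∣ v ∣ ≤ ∣ a ∣) (val≡v g f~g) val≤a) ⟩
    suc ∣ a ∣                     ≡⟨ ∣2*n+1∣ a ⟨
    ∣ 2 * a + 1 ∣                 ≤⟨ ∣m∣≤∣2*m+1#2*n+1∣ (2 * a + 1) (2 * bound f zs + 1) ⟩
    ∣ runBound a (bound f zs) ∣   ∎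
    where open ≤-Reasoning
  run-bounded {f} {g} {zs} a (aborts y Vy) f~g val≤a = begin
    ∣ 2 * y + 1 ∣                 ≡⟨ ∣2*n+1∣ y ⟩
    suc ∣ y ∣                     ≤⟨ s≤s (V-bounded f _ y Vy) ⟩
    suc ∣ bound f zs ∣            ≡⟨ ∣2*n+1∣ (bound f zs) ⟨
    ∣ 2 * bound f zs + 1 ∣        ≤⟨ ∣n∣≤∣2*m+1#2*n+1∣ (2 * a + 1) (2 * bound f zs + 1) ⟩
    ∣ runBound a (bound f zs) ∣   ∎
    where open ≤-Reasoning

  firstOdd-run :
    ∀ {f zs} {val : Fin k → (ℕ → ℕ) → ℕ} {r : Fin k → ℕ} →
    (∀ i → Run f zs (val i) (r i)) →
    (firstOdd r ≡ 0 × (∀ i g → Agree f g zs → val i g ≡ ⌊ r i /2⌋)) ⊎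
    (∃ λ y → firstOdd r ≡ 2 * y + 1 × V f zs y)
  firstOdd-run {zero}  R = inj₁ (refl , λ ())
  firstOdd-run {suc k} {r = r} R with r zero in r₀≡ | R zero | firstOdd-run (λ i → R (suc i))
  ... | _ | aborts y Vy     | _                 = inj₂ (y , ifEven-odd y _ _ , Vy)
  ... | _ | returns v val≡v | inj₂ (y , eq , Vy) = inj₂ (y , trans (ifEven-even v _ _) eq , Vy)
  ... | _ | returns v val≡v | inj₁ (eq , vals)   = inj₁ (trans (ifEven-even v _ _) eq , λ
    { zero g f~g    → trans (val≡v g f~g) (sym (trans (cong ⌊_/2⌋ r₀≡) (⌊2*n/2⌋ v)))
    ; (suc i) g f~g → vals i g f~g })

  record Guard (φ : Fun n) : Set where
    field
      run          : Fun (n + m)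
      run-feasible : Feasible run
      run-correct  : ∀ f xs → Run f (drop n xs) (λ g → φ g (take n xs)) (run f xs)

  open Guard public

  run-++ : ∀ {φ : Fun n} (G : Guard φ) f xs zs →
           Run f zs (λ g → φ g xs) (run G f (xs ++ zs))
  run-++ {φ = φ} G f xs zs =
    subst₂ (λ ys zs′ → Run f zs′ (λ g → φ g ys) (run G f (xs ++ zs)))
      (take-++ xs zs) (drop-++ xs zs) (run-correct G f (xs ++ zs))

  -- The simulation follows the derivation of `φ` and propagates aborts. Only `query` consults the
  -- oracle, and there `V?` is decided before the answer is passed on.
  guard : ∀ {φ : Fun n} → Feasible φ → Guard φ
  guard zero = record
    { run-feasible = zero
    ; run-correct  = λ f xs → returns 0 (λ g _ → refl)
    }
  guard (double Φ) = let G = guard Φ in record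
    { run          = λ f xs → ifEven (run G f xs) (2 * (2 * ⌊ run G f xs /2⌋)) (run G f xs)
    ; run-feasible = ifEven-feasible (run-feasible G)
        (double (double (half (run-feasible G)))) (run-feasible G)
    ; run-correct  = λ f xs → run-bind (λ v → 2 * (2 * v)) (run-correct G f xs)
        λ v φ≡v → returns (2 * v) (λ g f~g → cong (2 *_) (φ≡v g f~g))
    }
  guard (double+1 Φ) = let G = guard Φ in record
    { run          = λ f xs → ifEven (run G f xs) (2 * (2 * ⌊ run G f xs /2⌋ + 1)) (run G f xs)
    ; run-feasible = ifEven-feasible (run-feasible G)
        (double (double+1 (half (run-feasible G)))) (run-feasible G)
    ; run-correct  = λ f xs → run-bind (λ v → 2 * (2 * v + 1)) (run-correct G f xs)
        λ v φ≡v → returns (2 * v + 1) (λ g f~g → cong (λ v → 2 * v + 1) (φ≡v g f~g))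
    }
  guard {n} (var i) = record
    { run-feasible = double (compose (var i) (take-map n))
    ; run-correct  = λ f xs → returns _ (λ g _ → refl)
    }
  guard {n} (sharp Φ Ψ) = let G = guard Φ ; H = guard Ψ in record
    { run          = λ f xs →
        ifEven (run G f xs)
          (ifEven (run H f xs) (2 * (⌊ run G f xs /2⌋ # ⌊ run H f xs /2⌋)) (run H f xs))
          (run G f xs)
    ; run-feasible = ifEven-feasible (run-feasible G)
        (ifEven-feasible (run-feasible H)
          (double (sharp (half (run-feasible G)) (half (run-feasible H))))
          (run-feasible H))
        (run-feasible G)
    ; run-correct  = λ f xs →
        run-bind (λ v → ifEven (run H f xs) (2 * (v # ⌊ run H f xs /2⌋)) (run H f xs))
          (run-correct G f xs)
        λ v φ≡v → run-bind (λ w → 2 * (v # w)) (run-correct H f xs)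
        λ w ψ≡w → returns (v # w) (λ g f~g → cong₂ _#_ (φ≡v g f~g) (ψ≡w g f~g))
    }
  guard {n} (query Φ) = let G = guard Φ in record
    { run          = λ f xs →
        ifEven (run G f xs) (ask f (drop n xs) ⌊ run G f xs /2⌋) (run G f xs)
    ; run-feasible = ifEven-feasible (run-feasible G)
        (ifZero-feasible
          (compose V?-feasible (half (run-feasible G) ∷-map drop-map n))
          (double (query (half (run-feasible G))))
          (double+1 (half (run-feasible G))))
        (run-feasible G)
    ; run-correct  = λ f xs → run-bind (ask f (drop n xs)) (run-correct G f xs)
        λ v φ≡v → run-map (λ g f~g → cong g (φ≡v g f~g)) (ask-correct f (drop n xs) v)
    }
    where
    ask : (ℕ → ℕ) → Vec ℕ m → ℕ → ℕ
    ask f zs v = ifZero (flag (V? f zs v)) (2 * f v) (2 * v + 1)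

    ask-correct : ∀ f zs v → Run f zs (λ g → g v) (ask f zs v)
    ask-correct f zs v with V? f zs v
    ... | yes Vv = aborts v Vv
    ... | no ¬Vv = returns (f v) (λ g f~g → f~g v ¬Vv)
  guard {n} (substitute {φ = φ} {γ} Φ Γ) = record
    { run          = λ f xs → ifEven (abort f xs) (run F f (args f xs ++ drop n xs)) (abort f xs)
    ; run-feasible = ifEven-feasible abort-feasible
        (compose (run-feasible F)
          (++-map (tabulate-map (λ i → half (run-feasible (G i)))) (drop-map n)))
        abort-feasible
    ; run-correct  = correct
    }
    where
    open ≡-Reasoning

    F = guard Φ
    G = λ i → guard (Γ i)

    abort : Fun (n + m)
    abort f xs = firstOdd (λ i → run (G i) f xs)

    abort-feasible : Feasible abort
    abort-feasible = firstOdd-feasible (λ i → run-feasible (G i))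

    args : (ℕ → ℕ) → Vec ℕ (n + m) → Vec ℕ _
    args f xs = tabulate (λ i → ⌊ run (G i) f xs /2⌋)

    correct : ∀ f xs → Run f (drop n xs) (λ g → φ g (γ g (take n xs)))
                (ifEven (abort f xs) (run F f (args f xs ++ drop n xs)) (abort f xs))
    correct f xs with firstOdd-run (λ i → run-correct (G i) f xs)
    ... | inj₂ (y , eq , Vy)
          rewrite eq | ifEven-odd y (run F f (args f xs ++ drop n xs)) (2 * y + 1) =
          aborts y Vy
    ... | inj₁ (eq , vals) rewrite eq = run-map
          (λ g f~g → cong (φ g) (begin
            γ g (take n xs)                              ≡⟨ tabulate∘lookup (γ g (take n xs)) ⟨
            tabulate (λ i → lookup (γ g (take n xs)) i)  ≡⟨ tabulate-cong (λ i → vals i g f~g) ⟩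
            args f xs                                    ∎))
          (run-++ F f (args f xs) (drop n xs))
  guard {suc n} (recursion {φ = φ} {κ} {η₀ = η₀} {η₁} Γ H₀ H₁ Κ φ-0 φ-2y φ-2y+1 φ≤κ) = record
    { run          = rec
    ; run-feasible = recursion
        (run-feasible (guard Γ)) (step-feasible (guard H₀)) (step-feasible (guard H₁))
        -- `Κ` is evaluated at `f` without a guard: since `f` agrees with itself, `κ` at `f` already
        -- bounds every returned value.
        (runBound-feasible (compose Κ (take-map (suc n))) (weaken (suc n) bound-feasible))
        (λ f xs → refl)
        (λ f xs y y>0 → binaryRec-2y _ _ _ y y>0)
        (λ f xs y → binaryRec-2y+1 _ _ _ y)
        (λ f xs y → run-bounded (κ f (y ∷ take n xs)) (correct f xs y) (λ _ _ → refl)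
          (φ≤κ f (take n xs) y))
    ; run-correct  = λ { f (y ∷ xs) → correct f xs y }
    }
    where
    step : ∀ {η : Fun (2 + n)} → Guard η → Fun (2 + n + m)
    step G f xs = ifEven (head xs) (run G f (⌊ head xs /2⌋ ∷ tail xs)) (head xs)

    step-feasible : ∀ {η : Fun (2 + n)} (G : Guard η) → Feasible (step G)
    step-feasible G = ifEven-feasible head-feasible
      (compose (run-feasible G) (half head-feasible ∷-map tail-map)) head-feasible

    rec : Fun (suc n + m)
    rec f xs = binaryRec (run (guard Γ) f (tail xs))
      (λ y r → step (guard H₀) f (r ∷ y ∷ tail xs))
      (λ y r → step (guard H₁) f (r ∷ y ∷ tail xs))
      (head xs)

    step-correct : ∀ {η : Fun (2 + n)} (G : Guard η) f xs y {val r} →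
      (∀ g → val g ≡ η g (φ g (y ∷ take n xs) ∷ y ∷ take n xs)) →
      Run f (drop n xs) (λ g → φ g (y ∷ take n xs)) r →
      Run f (drop n xs) val (step G f (r ∷ y ∷ xs))
    step-correct {η} G f xs y val≡ R =
      run-bind (λ v → run G f (v ∷ y ∷ xs)) R λ v φ≡v →
        run-map (λ g f~g → trans (val≡ g) (cong (λ v → η g (v ∷ y ∷ take n xs)) (φ≡v g f~g)))
          (run-correct G f (v ∷ y ∷ xs))

    correct : ∀ f xs y →
      Run f (drop n xs) (λ g → φ g (y ∷ take n xs)) (rec f (y ∷ xs))
    correct f xs = binary-induction _
      (run-map (λ g _ → φ-0 g _) (run-correct (guard Γ) f xs))
      (λ y y>0 R → subst (Run f _ _) (sym (binaryRec-2y _ _ _ y y>0))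
        (step-correct (guard H₀) f xs y (λ g → φ-2y g _ y y>0) R))
      (λ y R → subst (Run f _ _) (sym (binaryRec-2y+1 _ _ _ y))
        (step-correct (guard H₁) f xs y (λ g → φ-2y+1 g _ y) R))
  guard (respects Φ ψ≡φ) = let G = guard Φ in record
    { run-feasible = run-feasible G
    ; run-correct  = λ f xs → run-map (λ g _ → ψ≡φ g _) (run-correct G f xs)
    }

-- Reaching a fixed point by nested iteration.

iterate-+ : ∀ (h : ℕ → ℕ) a s t →
            iterate (λ _ → h) (iterate (λ _ → h) a s) t ≡ iterate (λ _ → h) a (t + s)
iterate-+ h a s zero    = refl
iterate-+ h a s (suc t) = cong h (iterate-+ h a s t)

iterate-invariant : ∀ (P : ℕ → Set) {h a} → (∀ t s → P s → P (h t s)) → P a →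
                    ∀ t → P (iterate h a t)
iterate-invariant P step Pa zero    = Pa
iterate-invariant P step Pa (suc t) = step t _ (iterate-invariant P step Pa t)

-- A rank-increasing map h with small values is iterated up to a fixed
-- point. As long as none is reached, ranks exceed the number of steps
-- made; running count s > μ s steps at a time hence doubles
-- that number each time, and the points passed are pairwise distinct.
module FixedPoint
  (h μ count : ℕ → ℕ) (b : ℕ)
  (progress : ∀ s → h s ≡ s ⊎ (∣ h s ∣ ≤ b × μ s < μ (h s)))
  (μ<count : ∀ s → μ s < count s)
  where

  Fixed : ℕ → Set
  Fixed s = h s ≡ s

  orbit : ℕ → ℕ
  orbit = iterate (λ _ → h) 0

  leap : ℕ → ℕ
  leap s = iterate (λ _ → h) s (count s)

  leaps : ℕ → ℕ
  leaps = iterate (λ _ → leap) 0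

  orbit-bounded : ∀ t → ∣ orbit t ∣ ≤ b
  orbit-bounded = iterate-invariant (λ s → ∣ s ∣ ≤ b) step z≤n
    where
    step : ∀ _ s → ∣ s ∣ ≤ b → ∣ h s ∣ ≤ b
    step _ s ∣s∣≤b with progress s
    ... | inj₁ fixed       = subst (λ s → ∣ s ∣ ≤ b) (sym fixed) ∣s∣≤b
    ... | inj₂ (small , _) = small

  fixed-+ : ∀ s → Fixed (orbit s) → ∀ t → orbit (t + s) ≡ orbit s
  fixed-+ s fixed zero    = refl
  fixed-+ s fixed (suc t) = trans (cong h (fixed-+ s fixed t)) fixed

  fixed-≤ : ∀ {s t} → s ≤ t → Fixed (orbit s) → Fixed (orbit t)
  fixed-≤ {s} {t} s≤t fixed = subst Fixed
    (trans (sym (fixed-+ s fixed (t ∸ s))) (cong orbit (m∸n+n≡m s≤t))) fixed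

  ascends : ∀ t → ¬ Fixed (orbit t) → μ (orbit t) < μ (orbit (suc t))
  ascends t ¬fixed with progress (orbit t)
  ... | inj₁ fixed       = contradiction fixed ¬fixed
  ... | inj₂ (_ , μ<μ∘h) = μ<μ∘h

  increasing : ∀ {s} t → s < t → ¬ Fixed (orbit t) → μ (orbit s) < μ (orbit t)
  increasing (suc t) (s≤s s≤t) ¬fixed with m≤n⇒m<n∨m≡n s≤t
  ... | inj₁ s<t  = <-trans (increasing t s<t (¬fixed ∘ fixed-≤ (n≤1+n t)))
                            (ascends t (¬fixed ∘ fixed-≤ (n≤1+n t)))
  ... | inj₂ refl = ascends t (¬fixed ∘ fixed-≤ (n≤1+n t))

  t≤μ-orbit : ∀ t → ¬ Fixed (orbit t) → t ≤ μ (orbit t)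
  t≤μ-orbit zero    ¬fixed = z≤n
  t≤μ-orbit (suc t) ¬fixed =
    ≤-<-trans (t≤μ-orbit t (¬fixed ∘ fixed-≤ (n≤1+n t))) (ascends t (¬fixed ∘ fixed-≤ (n≤1+n t)))

  orbit-fixed : ∀ t → 2 ^ b ≤ t → Fixed (orbit t)
  orbit-fixed t 2^b≤t with h (orbit t) ≟ orbit t
  ... | yes fixed = fixed
  -- The `t + 1` points from `orbit 0` to `orbit t` lie below `2 ^ b`. Their ranks increase
  -- strictly, because a fixed point reached earlier would persist up to `t`.
  ... | no ¬fixed with Fin.pigeonhole (s≤s 2^b≤t) (λ i → fromℕ< (orbit<2^b (toℕ i)))
    where
    orbit<2^b : ∀ t → orbit t < 2 ^ b
    orbit<2^b t = <-≤-trans (n<2^∣n∣ (orbit t)) (^-monoʳ-≤ 2 (orbit-bounded t))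
  ... | i , j , i<j , eq =
    contradiction (cong μ (Fin.fromℕ<-injective _ _ _ _ eq))
      (<⇒≢ (increasing (toℕ j) i<j (¬fixed ∘ fixed-≤ (s≤s⁻¹ (Fin.toℕ<n j)))))

  time : ℕ → ℕ
  time zero    = 0
  time (suc n) = count (orbit (time n)) + time n

  leaps≡orbit : ∀ n → leaps n ≡ orbit (time n)
  leaps≡orbit zero    = refl
  leaps≡orbit (suc n) = trans (cong leap (leaps≡orbit n))
    (iterate-+ h 0 (time n) (count (orbit (time n))))

  -- It is `suc (time n)` that doubles: `time` starts at 0, and `time n < count` contributes the
  -- additional one.
  doubling : ∀ n → Fixed (orbit (time n)) ⊎ 2 ^ n ≤ suc (time n)
  doubling zero = inj₂ ≤-refl
  doubling (suc n) with h (orbit (time n)) ≟ orbit (time n) | doubling n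
  ... | yes fixed | _           = inj₁ (fixed-≤ (m≤n+m (time n) (count (orbit (time n)))) fixed)
  ... | no ¬fixed | inj₁ fixed  = contradiction fixed ¬fixed
  ... | no ¬fixed | inj₂ 2^n≤ = inj₂ (begin
    2 ^ n + (2 ^ n + 0)                           ≡⟨ cong (2 ^ n +_) (+-identityʳ (2 ^ n)) ⟩
    2 ^ n + 2 ^ n                                 ≤⟨ +-mono-≤ 2^n≤ 2^n≤ ⟩
    suc (time n + suc (time n))                   ≡⟨ cong suc (+-suc (time n) (time n)) ⟩
    suc (suc (time n) + time n)                   ≤⟨ s≤s (+-monoˡ-≤ (time n) time<count) ⟩
    suc (count (orbit (time n)) + time n)         ∎)
    where
    open ≤-Reasoning
    time<count : time n < count (orbit (time n))
    time<count = ≤-<-trans (t≤μ-orbit (time n) ¬fixed) (μ<count _)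

  leaps-fixed : ∀ n → b < n → Fixed (leaps n)
  leaps-fixed n b<n rewrite leaps≡orbit n with doubling n
  ... | inj₁ fixed = fixed
  -- Strictness of `b < n` is needed here: `2 ^ n ≤ suc (time n)` must yield `2 ^ b ≤ time n`.
  ... | inj₂ 2^n≤  = orbit-fixed (time n) (s≤s⁻¹ (≤-trans (^-monoʳ-< 2 (s≤s (s≤s z≤n)) b<n) 2^n≤))

-- Norms and first order majorants.

norm-≤ : ∀ f n {b} → (∀ y → ∣ y ∣ ≤ n → ∣ f y ∣ ≤ b) → norm f n ≤ b
norm-≤ f n {b} f≤b = max≤v⁺ z≤n
  (All.gmap⁺ (λ {y} → f≤b y) (All.all-filter (λ y → ∣ y ∣ ≤? n) (upTo (2 ^ n))))

≤-norm : ∀ f n y → ∣ y ∣ ≤ n → ∣ f y ∣ ≤ norm f n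
≤-norm f n y ∣y∣≤n = v≤max⁺ 0 _ (inj₂ (lose
  (∈-map⁺ (λ y → ∣ f y ∣)
    (∈-filter⁺ (λ y → ∣ y ∣ ≤? n)
      (∈-upTo⁺ (<-≤-trans (n<2^∣n∣ y) (^-monoʳ-≤ 2 ∣y∣≤n))) ∣y∣≤n))
  ≤-refl))

-- To be applied to the truncation, which is nowhere longer than `f`: its recursion length is then
-- at most that of `f`.
⟦⟧-mono-≤ : ∀ {f g : ℕ → ℕ} → (∀ y → ∣ f y ∣ ≤ ∣ g y ∣) →
            ∀ (P : SOPoly 1 l) xs → ⟦ P ⟧ [ f ] xs ≤ ⟦ P ⟧ [ g ] xs
⟦⟧-mono-≤ f≤g (const n) xs = ≤-refl
⟦⟧-mono-≤ f≤g (len i)   xs = ≤-refl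
⟦⟧-mono-≤ f≤g (P ⊕ Q)   xs = +-mono-≤ (⟦⟧-mono-≤ f≤g P xs) (⟦⟧-mono-≤ f≤g Q xs)
⟦⟧-mono-≤ f≤g (P ⊗ Q)   xs = *-mono-≤ (⟦⟧-mono-≤ f≤g P xs) (⟦⟧-mono-≤ f≤g Q xs)
⟦⟧-mono-≤ {f = f} {g} f≤g (app zero P) xs = norm-≤ f _ λ y ∣y∣≤ →
  ≤-trans (f≤g y) (≤-norm g _ y (≤-trans ∣y∣≤ (⟦⟧-mono-≤ f≤g P xs)))

-- An upper bound for the lengths of all entries. The initial 3 has length 2, so that a squared
-- length dominates a doubled one.
weight : Vec ℕ n → ℕ
weight []       = 3
weight (x ∷ xs) = (2 * x + 1) # (2 * weight xs + 1)

-- Each smash squares the length and adds one, so that one level pays for one sum or one product of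
-- lengths.
majorant : ℕ → Vec ℕ n → ℕ
majorant zero    xs = weight xs
majorant (suc c) xs = majorant c xs # majorant c xs

weight-feasible : ∀ n → Feasible {n} (λ f xs → weight xs)
weight-feasible zero    = respects (double+1 (double+1 zero)) (λ { f [] → refl })
weight-feasible (suc n) = respects
  (head-feasible ⊔ᶠ compose (weight-feasible n) tail-map) (λ { f (x ∷ xs) → refl })

majorant-feasible : ∀ c → Feasible {n} (λ f xs → majorant c xs)
majorant-feasible zero    = weight-feasible _
majorant-feasible (suc c) = sharp (majorant-feasible c) (majorant-feasible c)

1<∣majorant∣ : ∀ c (xs : Vec ℕ n) → 1 < ∣ majorant c xs ∣
1<∣majorant∣ zero [] = ≤-refl
1<∣majorant∣ zero (x ∷ xs) =
  ≤-trans (1<∣majorant∣ zero xs) (∣n∣≤∣2*m+1#2*n+1∣ x (weight xs))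
1<∣majorant∣ (suc c) xs rewrite ∣#∣ (majorant c xs) (majorant c xs) =
  s≤s (*-mono-≤ {1} {_} {1} (<⇒≤ (1<∣majorant∣ c xs)) (<⇒≤ (1<∣majorant∣ c xs)))

∣majorant∣² : ∀ c (xs : Vec ℕ n) → ∣ majorant c xs ∣ * ∣ majorant c xs ∣ ≤ ∣ majorant (suc c) xs ∣
∣majorant∣² c xs rewrite ∣#∣ (majorant c xs) (majorant c xs) = n≤1+n _

∣majorant∣+∣majorant∣ : ∀ c (xs : Vec ℕ n) →
                        ∣ majorant c xs ∣ + ∣ majorant c xs ∣ ≤ ∣ majorant (suc c) xs ∣
∣majorant∣+∣majorant∣ c xs = ≤-trans
  (subst (_≤ b * b) (cong (b +_) (+-identityʳ b)) (*-monoˡ-≤ b (1<∣majorant∣ c xs)))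
  (∣majorant∣² c xs)
  where b = ∣ majorant c xs ∣

∣majorant∣-step : ∀ c (xs : Vec ℕ n) → ∣ majorant c xs ∣ < ∣ majorant (suc c) xs ∣
∣majorant∣-step c xs = <-≤-trans
  (m<m+n b (<-trans (s≤s z≤n) (1<∣majorant∣ c xs))) (∣majorant∣+∣majorant∣ c xs)
  where b = ∣ majorant c xs ∣

∣majorant∣-mono-≤ : ∀ {c d} (xs : Vec ℕ n) → c ≤ d → ∣ majorant c xs ∣ ≤ ∣ majorant d xs ∣
∣majorant∣-mono-≤ {c = c} xs c≤d = go (≤⇒≤′ c≤d)
  where
  go : ∀ {d} → c ≤′ d → ∣ majorant c xs ∣ ≤ ∣ majorant d xs ∣
  go ≤′-refl         = ≤-refl
  go (≤′-step {d} p) = ≤-trans (go p) (<⇒≤ (∣majorant∣-step d xs))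

c≤∣majorant∣ : ∀ c (xs : Vec ℕ n) → c ≤ ∣ majorant c xs ∣
c≤∣majorant∣ zero    xs = z≤n
c≤∣majorant∣ (suc c) xs = ≤-<-trans (c≤∣majorant∣ c xs) (∣majorant∣-step c xs)

∣lookup∣≤∣weight∣ : ∀ (xs : Vec ℕ n) i → ∣ lookup xs i ∣ ≤ ∣ weight xs ∣
∣lookup∣≤∣weight∣ (x ∷ xs) zero    = ∣m∣≤∣2*m+1#2*n+1∣ x (weight xs)
∣lookup∣≤∣weight∣ (x ∷ xs) (suc i) =
  ≤-trans (∣lookup∣≤∣weight∣ xs i) (∣n∣≤∣2*m+1#2*n+1∣ x (weight xs))

∣majorant-tail∣ : ∀ c (xs : Vec ℕ (suc n)) → ∣ majorant c (tail xs) ∣ ≤ ∣ majorant c xs ∣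
∣majorant-tail∣ zero (x ∷ xs) = ∣n∣≤∣2*m+1#2*n+1∣ x (weight xs)
∣majorant-tail∣ (suc c) xs
  rewrite ∣#∣ (majorant c xs) (majorant c xs) | ∣#∣ (majorant c (tail xs)) (majorant c (tail xs)) =
  s≤s (*-mono-≤ (∣majorant-tail∣ c xs) (∣majorant-tail∣ c xs))

-- Second order polynomials under guesses, and the search for guesses.

depth : SOPoly k l → ℕ
depth (const n) = 0
depth (len i)   = 0
depth (P ⊕ Q)   = depth P ⊔ depth Q
depth (P ⊗ Q)   = depth P ⊔ depth Q
depth (app i P) = suc (depth P)

-- The level of `majorant` that suffices once norm values are replaced by guesses. A constant `n`
-- takes `n` levels, as each level adds at least one; `app` is free, because a guess is an argument
-- and so already counted in `weight`.
rank : SOPoly k l → ℕ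
rank (const n) = n
rank (len i)   = 0
rank (P ⊕ Q)   = suc (rank P ⊔ rank Q)
rank (P ⊗ Q)   = suc (rank P ⊔ rank Q)
rank (app i P) = rank P

-- In an argument list z ∷ zs, the guess ∣ z ∣ stands for a bound on
-- the norm of f at ∣ majorant c zs ∣.
module Guesses (c : ℕ) where

  Respects : ∀ i → (ℕ → ℕ) → Vec ℕ (i + l) → Set
  Respects zero    g xs = ⊤
  Respects (suc i) g xs =
    Respects i g (tail xs) × (∀ y → ∣ y ∣ ≤ ∣ majorant c (tail xs) ∣ → ∣ g y ∣ ≤ ∣ head xs ∣)

  -- Under `app` the inner polynomial has one guess fewer at its disposal. By induction it stays
  -- below the majorant of the tail, which is precisely the range for which the head guess bounds
  -- `g`; `rank P ≤ c` ensures that this range is wide enough.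
  ⟦⟧≤∣majorant∣ : ∀ i (P : SOPoly 1 l) {g xs} → depth P ≤ i → rank P ≤ c → Respects i g xs →
                  ⟦ P ⟧ [ g ] (drop i xs) ≤ ∣ majorant (rank P) xs ∣
  ⟦⟧-⟦⟧≤∣majorant∣ : ∀ i (P Q : SOPoly 1 l) {g xs} →
    depth P ⊔ depth Q ≤ i → rank P ⊔ rank Q < c → Respects i g xs →
    ⟦ P ⟧ [ g ] (drop i xs) ≤ ∣ majorant (rank P ⊔ rank Q) xs ∣ ×
    ⟦ Q ⟧ [ g ] (drop i xs) ≤ ∣ majorant (rank P ⊔ rank Q) xs ∣

  ⟦⟧≤∣majorant∣ i (const n) {xs = xs} _ _ _ = c≤∣majorant∣ n xs
  ⟦⟧≤∣majorant∣ i (len j) {xs = xs} _ _ _ =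
    subst (λ x → ∣ x ∣ ≤ ∣ weight xs ∣) (sym (lookup-drop i xs j)) (∣lookup∣≤∣weight∣ xs (i ↑ʳ j))
  ⟦⟧≤∣majorant∣ i (P ⊕ Q) {xs = xs} d≤i r<c resp =
    ≤-trans (+-mono-≤ (proj₁ both) (proj₂ both)) (∣majorant∣+∣majorant∣ (rank P ⊔ rank Q) xs)
    where both = ⟦⟧-⟦⟧≤∣majorant∣ i P Q {xs = xs} d≤i r<c resp
  ⟦⟧≤∣majorant∣ i (P ⊗ Q) {xs = xs} d≤i r<c resp =
    ≤-trans (*-mono-≤ (proj₁ both) (proj₂ both)) (∣majorant∣² (rank P ⊔ rank Q) xs)
    where both = ⟦⟧-⟦⟧≤∣majorant∣ i P Q {xs = xs} d≤i r<c resp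
  ⟦⟧≤∣majorant∣ (suc i) (app zero P) {g} {x ∷ xs} (s≤s d≤i) r≤c (resp , g≤x) = norm-≤ g _ λ y ∣y∣≤ →
    ≤-trans
      (g≤x y (≤-trans ∣y∣≤
        (≤-trans (⟦⟧≤∣majorant∣ i P {xs = xs} d≤i r≤c resp) (∣majorant∣-mono-≤ xs r≤c))))
      (≤-trans (∣lookup∣≤∣weight∣ (x ∷ xs) zero) (∣majorant∣-mono-≤ {d = rank P} (x ∷ xs) z≤n))

  ⟦⟧-⟦⟧≤∣majorant∣ i P Q {xs = xs} d≤i r<c resp =
    ≤-trans
      (⟦⟧≤∣majorant∣ i P {xs = xs} (m⊔n≤o⇒m≤o _ _ d≤i) (m⊔n≤o⇒m≤o _ _ (<⇒≤ r<c)) resp)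
      (∣majorant∣-mono-≤ xs (m≤m⊔n (rank P) (rank Q))) ,
    ≤-trans
      (⟦⟧≤∣majorant∣ i Q {xs = xs}
        (m⊔n≤o⇒n≤o (depth P) _ d≤i) (m⊔n≤o⇒n≤o (rank P) _ (<⇒≤ r<c)) resp)
      (∣majorant∣-mono-≤ xs (m≤n⊔m (rank P) (rank Q)))

  Refutes : ∀ i → (ℕ → ℕ) → Vec ℕ (i + l) → ℕ → Set
  Refutes zero    f xs y = ⊥
  Refutes (suc i) f xs y =
    Refutes i f (tail xs) y ⊎ (∣ y ∣ ≤ ∣ majorant c (tail xs) ∣ × ∣ head xs ∣ < ∣ f y ∣)

  refutes? : ∀ i f (xs : Vec ℕ (i + l)) y → Dec (Refutes i f xs y)
  refutes? zero    f xs y = no (λ ())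
  refutes? (suc i) f xs y =
    refutes? i f (tail xs) y ⊎-dec
    (∣ y ∣ ≤? ∣ majorant c (tail xs) ∣ ×-dec ∣ head xs ∣ <? ∣ f y ∣)

  refutes?-feasible : ∀ i →
    Feasible {suc (i + l)} (λ f ys → flag (refutes? i f (tail ys) (head ys)))
  refutes?-feasible zero    = zero
  refutes?-feasible (suc i) =
    ⊎-dec-feasible
      (compose (refutes?-feasible i) (head-feasible ∷-map compose-map tail-map tail-map))
      (×-dec-feasible
        (∣∣≤?-feasible head-feasible
          (compose (majorant-feasible c) (compose-map tail-map tail-map)))
        (∣∣<?-feasible (compose head-feasible tail-map) (query head-feasible)))

  refutes-bounded : ∀ i f (xs : Vec ℕ (i + l)) y → Refutes i f xs y → ∣ y ∣ ≤ ∣ majorant c xs ∣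
  refutes-bounded (suc i) f xs y (inj₁ p)       =
    ≤-trans (refutes-bounded i f (tail xs) y p) (∣majorant-tail∣ c xs)
  refutes-bounded (suc i) f xs y (inj₂ (p , _)) = ≤-trans p (∣majorant-tail∣ c xs)

  -- Answers that refute a guess become 0 and all others are kept. This obeys every guess, never
  -- lengthens a value, and agrees with `f` wherever a guarded run continues.
  truncate : ∀ i → (ℕ → ℕ) → Vec ℕ (i + l) → ℕ → ℕ
  truncate i f xs y = ifZero (flag (refutes? i f xs y)) (f y) 0

  truncate-unrefuted : ∀ i f (xs : Vec ℕ (i + l)) y → ¬ Refutes i f xs y → truncate i f xs y ≡ f y
  truncate-unrefuted i f xs y ¬p with refutes? i f xs y
  ... | yes p = contradiction p ¬p
  ... | no _  = refl

  ∣truncate∣≤ : ∀ i f (xs : Vec ℕ (i + l)) y → ∣ truncate i f xs y ∣ ≤ ∣ f y ∣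
  ∣truncate∣≤ i f xs y with refutes? i f xs y
  ... | yes _ = z≤n
  ... | no _  = ≤-refl

  -- Truncations at consecutive levels are different functions, so the induction on `i` runs over an
  -- arbitrary `g` that is 0 or an unrefuted value of `f` at each point.
  unrefuted-respects : ∀ i {f g} (xs : Vec ℕ (i + l)) →
    (∀ y → g y ≡ 0 ⊎ (g y ≡ f y × ¬ Refutes i f xs y)) → Respects i g xs
  unrefuted-respects zero    xs g≈f = tt
  unrefuted-respects (suc i) {f} {g} xs g≈f = unrefuted-respects i (tail xs) weaker , bounded
    where
    weaker : ∀ y → g y ≡ 0 ⊎ (g y ≡ f y × ¬ Refutes i f (tail xs) y)
    weaker y with g≈f y
    ... | inj₁ gy≡0         = inj₁ gy≡0
    ... | inj₂ (gy≡fy , ¬p) = inj₂ (gy≡fy , ¬p ∘ inj₁)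

    bounded : ∀ y → ∣ y ∣ ≤ ∣ majorant c (tail xs) ∣ → ∣ g y ∣ ≤ ∣ head xs ∣
    bounded y ∣y∣≤ with g≈f y
    ... | inj₁ gy≡0         rewrite gy≡0  = z≤n
    ... | inj₂ (gy≡fy , ¬p) rewrite gy≡fy = ≮⇒≥ λ x<fy → ¬p (inj₂ (∣y∣≤ , x<fy))

  truncate-respects : ∀ i f (xs : Vec ℕ (i + l)) → Respects i (truncate i f xs) xs
  truncate-respects i f xs = unrefuted-respects i xs cases
    where
    cases : ∀ y → truncate i f xs y ≡ 0 ⊎ (truncate i f xs y ≡ f y × ¬ Refutes i f xs y)
    cases y with refutes? i f xs y
    ... | yes _ = inj₁ refl
    ... | no ¬p = inj₂ (refl , ¬p)

  -- Results are encoded as in `Run`. With `i = 0` there is nothing to refute, so an `Attempt F 0`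
  -- always returns the value.
  record Attempt (F : Fun l) (i : ℕ) : Set where
    field
      result          : Fun (i + l)
      result-feasible : Feasible result
      result-correct  : ∀ f xs → result f xs ≡ 2 * F f (drop i xs) ⊎
                        (∃ λ y → result f xs ≡ 2 * y + 1 × Refutes i f xs y)

  open Attempt

  -- The guess z is of the form f y, for a query y that is replaced as
  -- long as it is refuted by a query of the same level.
  module Search {F : Fun l} {i} (A : Attempt F (suc i)) where

    Improves : (ℕ → ℕ) → Vec ℕ (i + l) → (y y′ : ℕ) → Set
    Improves f xs y y′ = ∣ y′ ∣ ≤ ∣ majorant c xs ∣ × ∣ f y ∣ < ∣ f y′ ∣

    improves? : ∀ f xs y y′ → Dec (Improves f xs y y′)
    improves? f xs y y′ = ∣ y′ ∣ ≤? ∣ majorant c xs ∣ ×-dec ∣ f y ∣ <? ∣ f y′ ∣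

    response : (ℕ → ℕ) → Vec ℕ (i + l) → ℕ → ℕ
    response f xs y = result A f (f y ∷ xs)

    replace : (ℕ → ℕ) → Vec ℕ (i + l) → (y y′ : ℕ) → ℕ
    replace f xs y y′ = ifZero (flag (improves? f xs y y′)) y y′

    -- Leaves `y` in place when the response is a value, and also when it is a query that refutes
    -- only earlier guesses; in the latter case the refutation is left to the levels below.
    improve : (ℕ → ℕ) → Vec ℕ (i + l) → ℕ → ℕ
    improve f xs y =
      ifEven (response f xs y) y (replace f xs y ⌊ response f xs y /2⌋)

    response-feasible : Feasible {suc (i + l)} (λ f ys → response f (tail ys) (head ys))
    response-feasible = compose (result-feasible A) (query head-feasible ∷-map tail-map)

    improve-feasible : Feasible {suc (i + l)} (λ f ys → improve f (tail ys) (head ys))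
    improve-feasible = ifEven-feasible response-feasible head-feasible
      (ifZero-feasible
        (×-dec-feasible
          (∣∣≤?-feasible (half response-feasible) (compose (majorant-feasible c) tail-map))
          (∣∣<?-feasible (query head-feasible) (query (half response-feasible))))
        head-feasible
        (half response-feasible))

    Progress : (ℕ → ℕ) → Vec ℕ (i + l) → (y y′ : ℕ) → Set
    Progress f xs y y′ = y′ ≡ y ⊎ Improves f xs y y′

    replace-progress : ∀ f xs y y′ → Progress f xs y (replace f xs y y′)
    replace-progress f xs y y′ with improves? f xs y y′
    ... | yes p = inj₂ p
    ... | no _  = inj₁ refl

    improve-progress : ∀ f xs y → Progress f xs y (improve f xs y)
    improve-progress f xs y = go (response f xs y)
      where
      go : ∀ r → Progress f xs y (ifEven r y (replace f xs y ⌊ r /2⌋))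
      go r with replace f xs y ⌊ r /2⌋ | replace-progress f xs y ⌊ r /2⌋
      ... | y′ | p = either r
        where
        either : ∀ r → Progress f xs y (ifEven r y y′)
        either zero          = inj₁ refl
        either (suc zero)    = p
        either (suc (suc r)) = either r

    improve-odd : ∀ f xs y y′ → response f xs y ≡ 2 * y′ + 1 →
                  improve f xs y ≡ replace f xs y y′
    improve-odd f xs y y′ eq rewrite eq =
      trans (ifEven-odd y′ _ _) (cong (replace f xs y) (⌊2*n+1/2⌋ y′))

    fixed⇒¬improves : ∀ f xs y y′ → response f xs y ≡ 2 * y′ + 1 → improve f xs y ≡ y →
                      ¬ Improves f xs y y′
    fixed⇒¬improves f xs y y′ eq fixed p@(_ , fy<fy′) =
      <-irrefl (cong (λ y → ∣ f y ∣) y≡y′) fy<fy′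
      where
      open ≡-Reasoning

      replaced : replace f xs y y′ ≡ y′
      replaced with improves? f xs y y′
      ... | yes _ = refl
      ... | no ¬p = contradiction p ¬p

      y≡y′ : y ≡ y′
      y≡y′ = begin
        y                     ≡⟨ fixed ⟨
        improve f xs y        ≡⟨ improve-odd f xs y y′ eq ⟩
        replace f xs y y′     ≡⟨ replaced ⟩
        y′                    ∎

    leap : (ℕ → ℕ) → Vec ℕ (i + l) → ℕ → ℕ
    leap f xs y = iterate (λ _ → improve f xs) y ∣ 2 * f y + 1 ∣

    -- Appending a digit adds one to a length, which gives `∣ f y ∣ + 1` steps per leap and
    -- `∣ majorant c xs ∣ + 1` leaps, the counts that the fixed point argument needs for the rank
    -- `∣ f y ∣`. The search starts at the query 0.
    final : Fun (i + l)
    final f xs = iterate (λ _ → leap f xs) 0 ∣ 2 * majorant c xs + 1 ∣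

    open module FP f xs = FixedPoint (improve f xs) (λ y → ∣ f y ∣) (λ y → ∣ 2 * f y + 1 ∣)
      ∣ majorant c xs ∣ (improve-progress f xs) (λ y → ≤-reflexive (sym (∣2*n+1∣ (f y))))
      using (leaps-fixed)

    final-fixed : ∀ f xs → improve f xs (final f xs) ≡ final f xs
    final-fixed f xs = leaps-fixed f xs _ (≤-reflexive (sym (∣2*n+1∣ (majorant c xs))))

    improve-bounded : ∀ f xs {b} y → ∣ majorant c xs ∣ ≤ b → ∣ y ∣ ≤ b → ∣ improve f xs y ∣ ≤ b
    improve-bounded f xs {b} y m≤b y≤b with improve-progress f xs y
    ... | inj₁ eq = subst (λ y → ∣ y ∣ ≤ b) (sym eq) y≤b
    ... | inj₂ (y′≤m , _) = ≤-trans y′≤m m≤b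

    iterates-bounded : ∀ f xs {b} y → ∣ majorant c xs ∣ ≤ b → ∣ y ∣ ≤ b → ∀ t →
                       ∣ iterate (λ _ → improve f xs) y t ∣ ≤ b
    iterates-bounded f xs {b} y m≤b =
      iterate-invariant (λ y → ∣ y ∣ ≤ b) (λ _ y → improve-bounded f xs y m≤b)

    leap-feasible : Feasible {suc (i + l)} (λ f ys → leap f (tail ys) (head ys))
    leap-feasible = iterate-feasible
      {η = λ f zs → improve f (tail (tail (tail zs))) (head zs)}
      head-feasible
      (compose improve-feasible
        (head-feasible ∷-map compose-map tail-map (compose-map tail-map tail-map)))
      -- Here the starting query is an arbitrary argument, possibly longer than the majorant, so
      -- both enter the bound.
      (head-feasible ⊔ᶠ compose (majorant-feasible c) tail-map)
      (double+1 (query head-feasible))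
      (λ f ys → iterates-bounded f (tail ys) (head ys)
        (∣n∣≤∣2*m+1#2*n+1∣ (head ys) (majorant c (tail ys)))
        (∣m∣≤∣2*m+1#2*n+1∣ (head ys) (majorant c (tail ys))))

    final-feasible : Feasible final
    final-feasible = iterate-feasible
      {η = λ f zs → leap f (tail (tail zs)) (head zs)}
      zero
      (compose leap-feasible (head-feasible ∷-map compose-map tail-map tail-map))
      (majorant-feasible c)
      (double+1 (majorant-feasible c))
      (λ f xs → iterate-invariant (λ y → ∣ y ∣ ≤ ∣ majorant c xs ∣)
        (λ _ y y≤ → iterates-bounded f xs y ≤-refl y≤ ∣ 2 * f y + 1 ∣) z≤n)

    search : Attempt F i
    search .result f xs = response f xs (final f xs)
    search .result-feasible = compose response-feasible (final-feasible ∷-map identity-map)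
    search .result-correct f xs with result-correct A f (f (final f xs) ∷ xs)
    ... | inj₁ eq                     = inj₁ eq
    ... | inj₂ (y , eq , inj₁ refute) = inj₂ (y , eq , refute)
    -- A refutation on this level is literally an improvement of the final query, which a fixed
    -- point excludes.
    ... | inj₂ (y , eq , inj₂ better) =
      contradiction better (fixed⇒¬improves f xs (final f xs) y eq (final-fixed f xs))

  attempt₀ : ∀ {F : Fun l} i → Attempt F i → Attempt F 0
  attempt₀ zero    A = A
  attempt₀ (suc i) A = attempt₀ i (Search.search A)

  attempt₀⇒Feasible : ∀ {F : Fun l} → Attempt F 0 → Feasible F
  attempt₀⇒Feasible {F = F} A = respects (half (result-feasible A)) value
    where
    value : ∀ f xs → F f xs ≡ ⌊ result A f xs /2⌋
    value f xs with result-correct A f xs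
    ... | inj₁ eq rewrite eq = sym (⌊2*n/2⌋ (F f xs))

-- The given recursion, run under guard.

module PolynomialRecursion
  (P Q : SOPoly 1 l)
  {G : Functional 1 l} {H : Functional 1 (suc (suc l))}
  (Gᶠ : BFF G) (Hᶠ : BFF H)
  (F* : Functional 1 (suc l))
  (F*-zero : ∀ f xs → F* [ f ] (xs ∷ʳ 0) ≡ G [ f ] xs)
  (F*-suc : ∀ f xs y → F* [ f ] (xs ∷ʳ suc y) ≡ H [ f ] (xs ∷ʳ F* [ f ] (xs ∷ʳ y) ∷ʳ y))
  (F*-bounded : ∀ f xs y → y ≤ ⟦ P ⟧ [ f ] xs → ∣ F* [ f ] (xs ∷ʳ y) ∣ ≤ ⟦ Q ⟧ [ f ] xs)
  (F*-stable : ∀ f xs y → y ≥ ⟦ P ⟧ [ f ] xs →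
    F* [ f ] (xs ∷ʳ y) ≡ F* [ f ] (xs ∷ʳ ⟦ P ⟧ [ f ] xs))
  (F*-determined : ∀ f xs f′ →
    (∀ y → y ≤ ⟦ P ⟧ [ f ] xs → F* [ f ] (xs ∷ʳ y) ≡ F* [ f′ ] (xs ∷ʳ y)) →
    ∀ y → F* [ f ] (xs ∷ʳ y) ≡ F* [ f′ ] (xs ∷ʳ y))
  where

  -- The sum dominates both summands, so one majorant bounds the number of steps and the values
  -- alike.
  d = depth (P ⊕ Q)
  c = rank (P ⊕ Q)

  open Guesses c

  open Guarded {m = d + l} (Refutes d) (refutes? d) (refutes?-feasible d)
    (λ f xs → majorant c xs) (majorant-feasible c) (refutes-bounded d)

  Gᵍ : Guard (diagonal G)
  Gᵍ = guard (BFF⇒Feasible Gᶠ)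

  Hᵍ : Guard (diagonal H)
  Hᵍ = guard (BFF⇒Feasible Hᶠ)

  step : (ℕ → ℕ) → Vec ℕ (d + l) → (t r : ℕ) → ℕ
  step f xs t r = ifEven r (run Hᵍ f ((drop d xs ∷ʳ ⌊ r /2⌋ ∷ʳ t) ++ xs)) r

  trace : (ℕ → ℕ) → Vec ℕ (d + l) → ℕ → ℕ
  trace f xs = iterate (step f xs) (run Gᵍ f (drop d xs ++ xs))

  -- `F*` is not known to be feasible and so has no `Guard`. But `Run` asks nothing of this kind:
  -- runs of `G` and `H` are chained along conditions 1 and 2, for all agreeing `g` simultaneously.
  trace-correct : ∀ f xs t → Run f xs (λ g → F* [ g ] (drop d xs ∷ʳ t)) (trace f xs t)
  trace-correct f xs zero =
    run-map (λ g _ → F*-zero g (drop d xs)) (run-++ Gᵍ f (drop d xs) xs)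
  trace-correct f xs (suc t) =
    run-bind (λ v → run Hᵍ f ((drop d xs ∷ʳ v ∷ʳ t) ++ xs)) (trace-correct f xs t) λ v F*≡v →
      run-map
        (λ g f~g → trans (F*-suc g (drop d xs) t)
          (cong (λ v → H [ g ] (drop d xs ∷ʳ v ∷ʳ t)) (F*≡v g f~g)))
        (run-++ Hᵍ f (drop d xs ∷ʳ v ∷ʳ t) xs)

  ⟦P⟧+⟦Q⟧≤ : ∀ f (xs : Vec ℕ (d + l)) →
             ⟦ P ⊕ Q ⟧ [ truncate d f xs ] (drop d xs) ≤ ∣ majorant c xs ∣
  ⟦P⟧+⟦Q⟧≤ f xs = ⟦⟧≤∣majorant∣ d (P ⊕ Q) {xs = xs} ≤-refl ≤-refl (truncate-respects d f xs)

  -- Condition 3 covers `t` up to the value of `P` at the truncation, and condition 4 freezes `F*`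
  -- from there on. This supplies the bound for every `t` that limited recursion asks for.
  F*-truncate-bounded : ∀ f xs t → ∣ F* [ truncate d f xs ] (drop d xs ∷ʳ t) ∣ ≤ ∣ majorant c xs ∣
  F*-truncate-bounded f xs t = ≤-trans
    (bounded (≤-total t (⟦ P ⟧ [ g ] ys)))
    (m+n≤o⇒n≤o (⟦ P ⟧ [ g ] ys) (⟦P⟧+⟦Q⟧≤ f xs))
    where
    g = truncate d f xs
    ys = drop d xs
    bounded : t ≤ ⟦ P ⟧ [ g ] ys ⊎ ⟦ P ⟧ [ g ] ys ≤ t → ∣ F* [ g ] (ys ∷ʳ t) ∣ ≤ ⟦ Q ⟧ [ g ] ys
    bounded (inj₁ t≤P) = F*-bounded g ys t t≤P
    bounded (inj₂ P≤t) = subst (λ v → ∣ v ∣ ≤ ⟦ Q ⟧ [ g ] ys)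
      (sym (F*-stable g ys t P≤t)) (F*-bounded g ys _ ≤-refl)

  -- `F*` at `f` may well exceed the majorant when the guesses are too small; the bound is therefore
  -- taken at the truncation, which shares every returned value.
  trace-bounded : ∀ f xs t → ∣ trace f xs t ∣ ≤ ∣ runBound (majorant c xs) (majorant c xs) ∣
  trace-bounded f xs t = run-bounded (majorant c xs) (trace-correct f xs t)
    (truncate-unrefuted d f xs) (F*-truncate-bounded f xs t)

  trace-feasible : Feasible {d + l} (λ f xs → trace f xs ∣ majorant c xs ∣)
  trace-feasible = iterate-feasible
    {η = λ f zs → step f (tail (tail zs)) (head (tail zs)) (head zs)}
    (compose (run-feasible Gᵍ) (++-map (drop-map d) identity-map))
    (ifEven-feasible head-feasible
      (compose (run-feasible Hᵍ)
        (++-map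
          (∷ʳ-map
            (∷ʳ-map (compose-map (drop-map d) (compose-map tail-map tail-map)) (half head-feasible))
            (compose head-feasible tail-map))
          (compose-map tail-map tail-map)))
      head-feasible)
    (runBound-feasible (majorant-feasible c) (majorant-feasible c))
    (majorant-feasible c)
    trace-bounded

  abort-persists : ∀ f xs y {t} → trace f xs t ≡ 2 * y + 1 → ∀ s → trace f xs (s + t) ≡ 2 * y + 1
  abort-persists f xs y eq zero    = eq
  abort-persists f xs y {t} eq (suc s) =
    trans (cong (step f xs (s + t)) (abort-persists f xs y eq s)) (ifEven-odd y _ _)

  -- An abort persists, so an even result at `N` means that all earlier stages returned as well;
  -- each returned value belongs both to `f` and to its truncation.
  agreement : ∀ f xs N → (∃ λ v → trace f xs N ≡ 2 * v) → ∀ t → t ≤ N →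
              F* [ truncate d f xs ] (drop d xs ∷ʳ t) ≡ F* [ f ] (drop d xs ∷ʳ t)
  agreement f xs N (v , eq) t t≤N = go (trace-correct f xs t) refl
    where
    go : ∀ {r} → Run f xs (λ g → F* [ g ] (drop d xs ∷ʳ t)) r → trace f xs t ≡ r →
         F* [ truncate d f xs ] (drop d xs ∷ʳ t) ≡ F* [ f ] (drop d xs ∷ʳ t)
    go (returns u F*≡u) _ = trans (F*≡u _ (truncate-unrefuted d f xs)) (sym (F*≡u f (λ _ _ → refl)))
    go (aborts y _) aborted = contradiction
      (begin
        0                                 ≡⟨ ifEven-even v 0 1 ⟨
        ifEven (2 * v) 0 1                ≡⟨ cong (λ r → ifEven r 0 1) eq ⟨
        ifEven (trace f xs N) 0 1         ≡⟨ cong (λ t → ifEven (trace f xs t) 0 1) (m∸n+n≡m t≤N) ⟨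
        ifEven (trace f xs (N ∸ t + t)) 0 1
          ≡⟨ cong (λ r → ifEven r 0 1) (abort-persists f xs y aborted (N ∸ t)) ⟩
        ifEven (2 * y + 1) 0 1            ≡⟨ ifEven-odd y 0 1 ⟩
        1                                 ∎)
      0≢1+n
      where open ≡-Reasoning

  limit : Fun l
  limit f xs = F* [ f ] (xs ∷ʳ ⟦ P ⟧ [ f ] xs)

  -- Condition 5 is applied with the truncation as its first function. Then agreement is needed only
  -- up to `P` at the truncation, which lies within the trace, while `P` at `f` may lie far beyond
  -- it. Condition 4 for the truncation leads from `P` at `f` back to `N`.
  limit-correct : ∀ f xs N → ⟦ P ⟧ [ truncate d f xs ] (drop d xs) ≤ N →
                  (∃ λ v → trace f xs N ≡ 2 * v) →
                  limit f (drop d xs) ≡ F* [ truncate d f xs ] (drop d xs ∷ʳ N)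
  limit-correct f xs N P≤N returned = begin
    F* [ f ] (ys ∷ʳ ⟦ P ⟧ [ f ] ys)
      ≡⟨ F*-determined g ys f (λ t t≤P → agreement f xs N returned t (≤-trans t≤P P≤N)) _ ⟨
    F* [ g ] (ys ∷ʳ ⟦ P ⟧ [ f ] ys)
      ≡⟨ F*-stable g ys _ (⟦⟧-mono-≤ (∣truncate∣≤ d f xs) P ys) ⟩
    F* [ g ] (ys ∷ʳ ⟦ P ⟧ [ g ] ys)
      ≡⟨ F*-stable g ys N P≤N ⟨
    F* [ g ] (ys ∷ʳ N) ∎
    where
    open ≡-Reasoning
    g = truncate d f xs
    ys = drop d xs

  attempt : Attempt limit d
  attempt = record
    { result          = λ f xs → trace f xs ∣ majorant c xs ∣
    ; result-feasible = trace-feasible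
    ; result-correct  = λ f xs → correct f xs (trace-correct f xs ∣ majorant c xs ∣) refl
    }
    where
    correct : ∀ f xs {r} → Run f xs (λ g → F* [ g ] (drop d xs ∷ʳ ∣ majorant c xs ∣)) r →
              trace f xs ∣ majorant c xs ∣ ≡ r →
              trace f xs ∣ majorant c xs ∣ ≡ 2 * limit f (drop d xs) ⊎
              (∃ λ y → trace f xs ∣ majorant c xs ∣ ≡ 2 * y + 1 × Refutes d f xs y)
    correct f xs (aborts y refuted) eq = inj₂ (y , eq , refuted)
    correct f xs (returns v F*≡v) eq = inj₁ (trans eq (cong (2 *_) (sym (trans
      (limit-correct f xs _ (m+n≤o⇒m≤o _ (⟦P⟧+⟦Q⟧≤ f xs)) (v , eq))
      (F*≡v _ (truncate-unrefuted d f xs))))))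

  limit-BFF : BFF (λ fs xs → limit (head fs) xs)
  -- The dummy place needs a basic feasible functional of rank `(1 , l)`. No projection is available
  -- for `l = 0`, but `G` is one for every `l`.
  limit-BFF = BFF-compose {γ = λ fs xs → G fs xs ∷ xs}
    (Feasible⇒BFF (attempt₀⇒Feasible (attempt₀ d attempt)))
    λ { zero → Gᶠ ; (suc i) → BFF-lookup i }

theorem9 : ∀ {l : ℕ} (P Q : SOPoly 1 l)
    (G : Functional 1 l) (H : Functional 1 (suc (suc l))) →
    BFF G → BFF H →
    (F* : Functional 1 (suc l)) →
    (∀ (f : ℕ → ℕ) (xs : Vec ℕ l) → F* [ f ] (xs ∷ʳ 0) ≡ G [ f ] xs) →
    (∀ (f : ℕ → ℕ) (xs : Vec ℕ l) (y : ℕ) →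
    F* [ f ] (xs ∷ʳ suc y) ≡ H [ f ] (xs ∷ʳ F* [ f ] (xs ∷ʳ y) ∷ʳ y)) →
    (∀ (f : ℕ → ℕ) (xs : Vec ℕ l) (y : ℕ) → y ≤ ⟦ P ⟧ [ f ] xs →
    ∣ F* [ f ] (xs ∷ʳ y) ∣ ≤ ⟦ Q ⟧ [ f ] xs) →
    (∀ (f : ℕ → ℕ) (xs : Vec ℕ l) (y : ℕ) → y ≥ ⟦ P ⟧ [ f ] xs →
    F* [ f ] (xs ∷ʳ y) ≡ F* [ f ] (xs ∷ʳ ⟦ P ⟧ [ f ] xs)) →
    (∀ (f : ℕ → ℕ) (xs : Vec ℕ l) (f′ : ℕ → ℕ) →
    (∀ (y : ℕ) → y ≤ ⟦ P ⟧ [ f ] xs →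
    F* [ f ] (xs ∷ʳ y) ≡ F* [ f′ ] (xs ∷ʳ y)) →
    ∀ (y : ℕ) → F* [ f ] (xs ∷ʳ y) ≡ F* [ f′ ] (xs ∷ʳ y)) →
    (F : Functional 1 l) →
    (∀ (f : ℕ → ℕ) (xs : Vec ℕ l) →
    F [ f ] xs ≡ F* [ f ] (xs ∷ʳ ⟦ P ⟧ [ f ] xs)) →
    BFF F
theorem9 P Q G H Gᶠ Hᶠ F* zero-eq suc-eq bounded stable determined F F≡ =
  BFF-respects limit-BFF (λ { (f ∷ []) xs → F≡ f xs })
  where open PolynomialRecursion P Q Gᶠ Hᶠ F* zero-eq suc-eq bounded stable determined
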